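{- Let $r\in\mathbb{N}$. Then there is a constant $c=c(r)>0$ such that the following holds. Let $G$ be an $r$-graph with average degree $d$ and vertex set $[n]$. Let $0<\tau\le1$ be such that $d(\sigma)\le cd\tau^{|\sigma|-1}$ for all $\sigma\subset[n]$ with $|\sigma|\ge2$. Then there is a function $C:\mathcal{P}[n]\to\mathcal{P}[n]$ such that for every independent set $I\subset[n]$ there exists $T\subset I$ with (a) $I\subset C(T)$, (b) $\mu(T)\le\tau$, (c) $|T|\le\tau n$, and (d) $\mu(C(T))\le1-c$. Moreover $C(T)\cap[w]=C(T\cap[w])\cap[w]$ for all $T\in\mathcal{P}[n]$ and $w\in[n]$. Indeed, the existence of $T\subset I$ with (a)–(d) holds for every set $I\subset[n]$ such that either $G[I]$ is $\lfloor c\tau^{r-1}d\rfloor$-degenerate or $e(G[I])\le c\tau^r e(G)$.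
   Context: An $r$-graph is an $r$-uniform hypergraph; $e(G)$ is its number of edges, $G[I]$ the induced subhypergraph on $I$; a set is independent if it contains no edge. $d(\sigma)$ is the number of edges containing $\sigma$, $d(v)=d(\{v\})$, and $d$ is the average vertex degree (assumed positive). The degree measure of $S\subset[n]$ is $\mu(S)=\frac1{nd}\sum_{u\in S}d(u)$. A hypergraph is $b$-degenerate if every subhypergraph has a vertex of degree at most $b$. $[w]=\{1,\dots,w\}$.
   Formalization: The parameter τ with 0<τ≤1 is taken to be rational rather than real (the constant c is likewise produced as a rational number, which loses nothing). -}

module Defs where

open import Data.Nat as ℕ using (ℕ; zero; suc)
open import Data.Integer as ℤ using (ℤ; +_)
open import Data.Rational as ℚ using (ℚ; 0ℚ; 1ℚ; _/_; _*_; _≤_; floor)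
open import Data.Bool using (Bool; true; false; _∧_)
open import Data.Fin using (Fin; toℕ)
open import Data.Fin.Subset using (Subset; _⊆_; _∈_; ∣_∣; Nonempty)
open import Data.Fin.Subset.Properties using (_⊆?_; _∈?_)
open import Data.List using (List; filter; length)
open import Data.Nat.ListAction using (sum)
open import Data.Bool using (T?)
open import Data.List.Membership.Propositional renaming (_∈_ to _∈ₗ_)
open import Data.Vec using (tabulate)
open import Data.Vec.Functional as VF using ()
open import Data.Fin.Base using ()
open import Data.List using (allFin) renaming (map to lmap)
open import Data.Product using (∃; _×_; Σ)
open import Relation.Nullary using (¬_)
open import Relation.Nullary.Decidable using (does)

-- An r-graph on vertex set [n] (represented as Fin n) is a duplicate-free
-- list of edges, each edge a subset of Fin n of size r (see Statement).
Hypergraph : ℕ → Set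
Hypergraph n = List (Subset n)

ℕtoℚ : ℕ → ℚ
ℕtoℚ m = (+ m) / 1

-- a / b as a rational, with the convention a / 0 = 0 (only used when b > 0)
_÷ℕ_ : ℕ → ℕ → ℚ
a ÷ℕ zero = 0ℚ
a ÷ℕ suc b = (+ a) / suc b

_^ℚ_ : ℚ → ℕ → ℚ
p ^ℚ zero = 1ℚ
p ^ℚ suc k = p * (p ^ℚ k)

module _ {n : ℕ} (G : Hypergraph n) where

  e : ℕ
  e = length G

  codeg : Subset n → ℕ
  codeg σ = length (filter (λ f → σ ⊆? f) G)

  deg : Fin n → ℕ
  deg v = length (filter (λ f → v ∈? f) G)

  degSum : Subset n → ℕ
  degSum S = sum (lmap deg (filter (λ v → v ∈? S) (allFin n)))

  avgDeg : ℚ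
  avgDeg = degSum (Data.Fin.Subset.⊤) ÷ℕ n

  -- degree measure μ(S) = (1/(n d)) Σ_{u∈S} d(u); note n·d = Σ_v d(v)
  μ : Subset n → ℚ
  μ S = degSum S ÷ℕ degSum (Data.Fin.Subset.⊤)

  inducedEdges : Subset n → List (Subset n)
  inducedEdges I = filter (λ f → f ⊆? I) G

  eInd : Subset n → ℕ
  eInd I = length (inducedEdges I)

  Independent : Subset n → Set
  Independent I = ∀ f → f ∈ₗ G → ¬ (f ⊆ I)

  -- G[I] is b-degenerate: every subhypergraph of G[I] (with at least one
  -- vertex) has a vertex of degree at most b.  A subhypergraph of G[I] has a
  -- nonempty vertex set W ⊆ I and an edge set consisting of some edges of G
  -- contained in W, selected by `keep`.
  Degenerate : ℤ → Subset n → Set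
  Degenerate b I =
    ∀ (W : Subset n) → W ⊆ I → Nonempty W → (keep : Subset n → Bool) →
    ∃ λ v → v ∈ W ×
      (+ length (filter (λ f → v ∈? f)
                 (filter (λ f → T? (keep f ∧ does (f ⊆? W))) G))) ℤ.≤ b

prefix : (n w : ℕ) → Subset n
prefix n w = tabulate (λ i → does (suc (toℕ i) ℕ.≤? w))

{-# OPTIONS --safe #-}

-- Scan the vertices in increasing order, keeping for each j ≤ r a multiset P j
-- of (r - j)-sets, with P 0 = G.  When v enters T, every f in P j whose least
-- element is v contributes f ∖ {v} to P (j + 1), unless f ∖ {v} contains a
-- nonempty σ whose degree in P (j + 1) exceeds half of its cap, which is of
-- order τ^j times the bound on the degree of σ in G; the codegree condition
-- keeps a single step from overshooting the cap.  A vertex of I enters T when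
-- the weighted number of sets it would contribute is large, and C(T) consists
-- of T and the vertices for which that number is not large.  This uses only
-- the part of T scanned before v, whence the online property.
--
-- The caps bound the sizes of the P j, hence the measure and size of T; the
-- exception is P r, whose members come from distinct edges of G[T], and these
-- are few by the assumption on I.  Conversely, a set of P j whose least
-- element is in C(T) but not in T is mostly lost by saturation only, and
-- saturated σ are counted by their degrees in P (j + 1).  So τ |P j| is
-- bounded by |P (j + 1)| plus the contribution of T and of the complement of
-- C(T); iterating from P 0 = G shows that this complement has measure bounded
-- below.

module Submission where

open import Defs
open import Data.Bool using (Bool; true; false; _∧_; _∨_; not; if_then_else_; T?)
import Data.Bool as Bool
open import Data.Bool.Properties using (∧-zeroʳ; ∧-identityʳ)
open import Data.Empty using (⊥-elim)
open import Data.Fin using (toℕ)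
open import Data.Fin.Properties using (toℕ<n)
open import Data.Fin.Subset.Properties using (_⊆?_; _∈?_; nonempty?; Empty-unique; ∣⊥∣≡0; ∣p∣≤n; p─q⊆p; x∈p∧x≢y⇒x∈p-y; x∈p⇒∣p-x∣<∣p∣)
open import Data.List using (List; []; _∷_; _++_; map; filter; filterᵇ; length; upTo; allFin)
import Data.List as List
open import Data.List.Membership.Propositional using () renaming (_∈_ to _∈ₗ_)
open import Data.List.Properties using (map-upTo; upTo-∷ʳ)
open import Data.List.Relation.Unary.All using (All; []; _∷_)
import Data.List.Relation.Unary.All as All
import Data.List.Relation.Unary.All.Properties as All
open import Data.List.Relation.Unary.Unique.Propositional using (Unique)
open import Data.Nat.ListAction using (sum)
open import Data.Nat.Tactic.RingSolver using (solve-∀)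
open import Data.Product using (Σ; ∃; ∃₂; _×_; _,_; proj₁)
open import Data.Sum using (_⊎_; inj₁; inj₂)
open import Data.Unit using (tt)
open import Data.Vec using ([]; _∷_; tabulate)
open import Function using (_∘_; id)
open import Level using (0ℓ)
open import Relation.Nullary using (Dec; does; yes; no; contradiction)
open import Relation.Nullary.Decidable using (dec-true)
open import Relation.Unary using (Pred; Decidable)
open import Relation.Binary.PropositionalEquality

-- A vertex `v` is weighted by `d(v) + d`, not by `d(v)`: one sum over `T` then bounds both the
-- measure and the size of `T`. In the degenerate case, where `|P r|` is only bounded by a multiple
-- of `|T|`, that bound is absorbed into half of the same sum. The cap on a single vertex in `G` is
-- `d(v) + d / E`. The flat part is needed for the caps to pass from a pair to its elements, but it
-- has to be small: the complement of `C(T)` may have many vertices of low degree, and their flat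
-- parts add up to as much as `n d / E`. Taking `E` large against the constants of the recursion
-- leaves a gain that only true degrees can supply, hence a complement of large measure. `T` lies in
-- `C(T)` although its links are large, so it is charged both with `C(T)` and with the complement.
-- Scanning with `τ / Δ` makes the measure of `T` at most `τ / (2 E)`, less than the gain. `Z` pays
-- for the passage from `τ` to `τ / Δ` in powers up to `r`.

module Combinatorics where

  open import Data.Nat
  open import Data.Nat.Properties
  open import Data.Fin.Subset using (Subset; ∣_∣; ⊥)

  -- Finite sums

  ∑ : {A : Set} → List A → (A → ℕ) → ℕ
  ∑ []       g = 0
  ∑ (x ∷ xs) g = g x + ∑ xs g

  [[_]] : Bool → ℕ
  [[ true ]] = 1
  [[ false ]] = 0

  module _ {A : Set} where

    sum-map : (g : A → ℕ) (xs : List A) → sum (map g xs) ≡ ∑ xs g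
    sum-map g []       = refl
    sum-map g (x ∷ xs) = cong (g x +_) (sum-map g xs)

    ∑-mono-All : {g h : A → ℕ} {xs : List A} → All (λ x → g x ≤ h x) xs → ∑ xs g ≤ ∑ xs h
    ∑-mono-All []       = z≤n
    ∑-mono-All (p ∷ ps) = +-mono-≤ p (∑-mono-All ps)

    ∑-mono : {g h : A → ℕ} (xs : List A) → (∀ x → g x ≤ h x) → ∑ xs g ≤ ∑ xs h
    ∑-mono xs p = ∑-mono-All (All.universal p xs)

    ∑-cong-All : {g h : A → ℕ} {xs : List A} → All (λ x → g x ≡ h x) xs → ∑ xs g ≡ ∑ xs h
    ∑-cong-All []       = refl
    ∑-cong-All (p ∷ ps) = cong₂ _+_ p (∑-cong-All ps)

    ∑-cong : {g h : A → ℕ} (xs : List A) → (∀ x → g x ≡ h x) → ∑ xs g ≡ ∑ xs h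
    ∑-cong xs p = ∑-cong-All (All.universal p xs)

    ∑-+ : (xs : List A) (g h : A → ℕ) → ∑ xs (λ x → g x + h x) ≡ ∑ xs g + ∑ xs h
    ∑-+ []       g h = refl
    ∑-+ (x ∷ xs) g h = trans (cong (g x + h x +_) (∑-+ xs g h)) (interchange (g x) (h x) _ _)
      where
      interchange : ∀ i j k l → i + j + (k + l) ≡ i + k + (j + l)
      interchange = solve-∀

    ∑-*ˡ : (k : ℕ) (xs : List A) (g : A → ℕ) → ∑ xs (λ x → k * g x) ≡ k * ∑ xs g
    ∑-*ˡ k []       g = sym (*-zeroʳ k)
    ∑-*ˡ k (x ∷ xs) g = trans (cong (k * g x +_) (∑-*ˡ k xs g)) (sym (*-distribˡ-+ k (g x) _))

    ∑-++ : (xs ys : List A) (g : A → ℕ) → ∑ (xs ++ ys) g ≡ ∑ xs g + ∑ ys g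
    ∑-++ []       ys g = refl
    ∑-++ (x ∷ xs) ys g = trans (cong (g x +_) (∑-++ xs ys g)) (sym (+-assoc (g x) _ _))

    ∑-0 : (xs : List A) → ∑ xs (λ _ → 0) ≡ 0
    ∑-0 []       = refl
    ∑-0 (x ∷ xs) = ∑-0 xs

    ∑-map : {B : Set} (f : A → B) (xs : List A) (g : B → ℕ) → ∑ (map f xs) g ≡ ∑ xs (g ∘ f)
    ∑-map f []       g = refl
    ∑-map f (x ∷ xs) g = cong (g (f x) +_) (∑-map f xs g)

    ∑-filter : {P : Pred A 0ℓ} (P? : Decidable P) (xs : List A) (g : A → ℕ) →
               ∑ (filter P? xs) g ≡ ∑ xs (λ x → [[ does (P? x) ]] * g x)
    ∑-filter P? []       g = refl
    ∑-filter P? (x ∷ xs) g with does (P? x)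
    ... | true  = cong₂ _+_ (sym (*-identityˡ (g x))) (∑-filter P? xs g)
    ... | false = ∑-filter P? xs g

    length≡∑ : (xs : List A) → length xs ≡ ∑ xs (λ _ → 1)
    length≡∑ []       = refl
    length≡∑ (x ∷ xs) = cong suc (length≡∑ xs)

  ∑-swap : {A B : Set} (xs : List A) (ys : List B) (g : A → B → ℕ) →
           ∑ xs (λ x → ∑ ys (g x)) ≡ ∑ ys (λ y → ∑ xs (λ x → g x y))
  ∑-swap []       ys g = sym (∑-0 ys)
  ∑-swap (x ∷ xs) ys g = trans (cong (∑ ys (g x) +_) (∑-swap xs ys g)) (sym (∑-+ ys (g x) _))

  length-filter : {A : Set} {P : Pred A 0ℓ} (P? : Decidable P) (xs : List A) →
                  length (filter P? xs) ≡ ∑ xs (λ x → [[ does (P? x) ]])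
  length-filter P? xs = trans (length≡∑ (filter P? xs))
    (trans (∑-filter P? xs _) (∑-cong xs (λ x → *-identityʳ _)))

  ∑-upTo-suc : ∀ n g → ∑ (upTo (suc n)) g ≡ g 0 + ∑ (upTo n) (g ∘ suc)
  ∑-upTo-suc n g = cong (g 0 +_) (trans (cong (λ xs → ∑ xs g) (sym (map-upTo suc n))) (∑-map suc (upTo n) g))

  ∑-upTo-∷ʳ : ∀ n g → ∑ (upTo (suc n)) g ≡ ∑ (upTo n) g + g n
  ∑-upTo-∷ʳ n g = trans (cong (λ xs → ∑ xs g) (sym (upTo-∷ʳ n)))
    (trans (∑-++ (upTo n) (n ∷ []) g) (cong (∑ (upTo n) g +_) (+-identityʳ (g n))))

  ∑-const : ∀ n c → ∑ (upTo n) (λ _ → c) ≡ n * c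
  ∑-const zero    c = refl
  ∑-const (suc n) c = trans (∑-upTo-suc n (λ _ → c)) (cong (c +_) (∑-const n c))

  all-upTo : ∀ {P : ℕ → Set} n → (∀ t → t < n → P t) → All P (upTo n)
  all-upTo n p = All.applyUpTo⁺₁ (λ t → t) n (λ {t} → p t)

  term≤∑-upTo : ∀ n g {t} → t < n → g t ≤ ∑ (upTo n) g
  term≤∑-upTo (suc n) g {zero}  _         = subst (g 0 ≤_) (sym (∑-upTo-suc n g)) (m≤m+n _ _)
  term≤∑-upTo (suc n) g {suc t} (s≤s t<n) = subst (g (suc t) ≤_) (sym (∑-upTo-suc n g))
    (≤-trans (term≤∑-upTo n (g ∘ suc) t<n) (m≤n+m _ (g 0)))

  ∑-point-≤ : ∀ n k → ∑ (upTo n) (λ t → [[ k ≡ᵇ t ]]) ≤ 1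
  ∑-point-≤ zero    k       = z≤n
  ∑-point-≤ (suc n) zero    = subst (_≤ 1) (sym (∑-upTo-suc n (λ t → [[ 0 ≡ᵇ t ]]))) (≤-reflexive (cong suc (∑-0 (upTo n))))
  ∑-point-≤ (suc n) (suc k) = subst (_≤ 1) (sym (∑-upTo-suc n (λ t → [[ suc k ≡ᵇ t ]]))) (∑-point-≤ n k)

  ∑-point : ∀ {n k} → k < n → ∑ (upTo n) (λ t → [[ k ≡ᵇ t ]]) ≡ 1
  ∑-point {n} {k} k<n = ≤-antisym (∑-point-≤ n k)
    (subst (_≤ ∑ (upTo n) (λ t → [[ k ≡ᵇ t ]])) (refl′ k) (term≤∑-upTo n (λ t → [[ k ≡ᵇ t ]]) k<n))
    where
    refl′ : ∀ k → [[ k ≡ᵇ k ]] ≡ 1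
    refl′ zero    = refl
    refl′ (suc k) = refl′ k

  -- Subsets of [n] as bit vectors, with vertices in ℕ

  mem : ∀ {n} → Subset n → ℕ → Bool
  mem []      _       = false
  mem (x ∷ p) zero    = x
  mem (x ∷ p) (suc t) = mem p t

  sub : ∀ {n} → Subset n → Subset n → Bool
  sub []          []      = true
  sub (true  ∷ σ) (y ∷ f) = y ∧ sub σ f
  sub (false ∷ σ) (y ∷ f) = sub σ f

  -- first f = n when f is empty
  first : ∀ {n} → Subset n → ℕ
  first []          = 0
  first (true  ∷ f) = 0
  first (false ∷ f) = suc (first f)

  dropFirst : ∀ {n} → Subset n → Subset n
  dropFirst []          = []
  dropFirst (true  ∷ f) = false ∷ f
  dropFirst (false ∷ f) = false ∷ dropFirst f

  insert : ∀ {n} → ℕ → Subset n → Subset n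
  insert _       []      = []
  insert zero    (_ ∷ σ) = true ∷ σ
  insert (suc t) (x ∷ σ) = x ∷ insert t σ

  subsets : ∀ n → List (Subset n)
  subsets zero    = [] ∷ []
  subsets (suc n) = map (true ∷_) (subsets n) ++ map (false ∷_) (subsets n)

  ∣f∣>0⇒first<n : ∀ {n} (f : Subset n) → 0 < ∣ f ∣ → first f < n
  ∣f∣>0⇒first<n (true  ∷ f) _ = z<s
  ∣f∣>0⇒first<n (false ∷ f) p = s<s (∣f∣>0⇒first<n f p)

  ∣dropFirst∣ : ∀ {n} (f : Subset n) → first f < n → ∣ f ∣ ≡ suc ∣ dropFirst f ∣
  ∣dropFirst∣ (true  ∷ f) _       = refl
  ∣dropFirst∣ (false ∷ f) (s<s p) = ∣dropFirst∣ f p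

  first<first-dropFirst : ∀ {n} (f : Subset n) → first f < n → first f < first (dropFirst f)
  first<first-dropFirst (true  ∷ f) _       = z<s
  first<first-dropFirst (false ∷ f) (s<s p) = s<s (first<first-dropFirst f p)

  mem-first : ∀ {n} (f : Subset n) → first f < n → mem f (first f) ≡ true
  mem-first (true  ∷ f) _       = refl
  mem-first (false ∷ f) (s<s p) = mem-first f p

  sub-dropFirst : ∀ {n} (σ f : Subset n) → sub σ (dropFirst f) ≡ true → sub σ f ≡ true
  sub-dropFirst []          []          s = refl
  sub-dropFirst (false ∷ σ) (true  ∷ f) s = s
  sub-dropFirst (false ∷ σ) (false ∷ f) s = sub-dropFirst σ f s

  sub-insert : ∀ {n} (σ f : Subset n) → first f < n → sub σ (dropFirst f) ≡ true → sub (insert (first f) σ) f ≡ true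
  sub-insert (false ∷ σ) (true  ∷ f) _       s = s
  sub-insert (false ∷ σ) (false ∷ f) (s<s p) s = sub-insert σ f p s

  sub-dropFirst⇒∌first : ∀ {n} (σ f : Subset n) → sub σ (dropFirst f) ≡ true → mem σ (first f) ≡ false
  sub-dropFirst⇒∌first []          []          s = refl
  sub-dropFirst⇒∌first (false ∷ σ) (true  ∷ f) s = refl
  sub-dropFirst⇒∌first (false ∷ σ) (false ∷ f) s = sub-dropFirst⇒∌first σ f s

  ∣insert∣ : ∀ {n t} (σ : Subset n) → t < n → mem σ t ≡ false → ∣ insert t σ ∣ ≡ suc ∣ σ ∣
  ∣insert∣ {t = zero}  (false ∷ σ) _       _ = refl
  ∣insert∣ {t = suc t} (true  ∷ σ) (s<s p) q = cong suc (∣insert∣ σ p q)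
  ∣insert∣ {t = suc t} (false ∷ σ) (s<s p) q = ∣insert∣ σ p q

  sub-unfold : ∀ {n} (f T : Subset n) → first f < n → mem T (first f) ≡ true → sub (dropFirst f) T ≡ true → sub f T ≡ true
  sub-unfold (true  ∷ f) (true ∷ T) _       _ s = s
  sub-unfold (false ∷ f) (x    ∷ T) (s<s p) q s = sub-unfold f T p q s

  mem-⊥ : ∀ n t → mem (⊥ {n}) t ≡ false
  mem-⊥ zero    t       = refl
  mem-⊥ (suc n) zero    = refl
  mem-⊥ (suc n) (suc t) = mem-⊥ n t

  ⊥-sub : ∀ {n} (f : Subset n) → sub ⊥ f ≡ true
  ⊥-sub []      = refl
  ⊥-sub (x ∷ f) = ⊥-sub f

  singleton-sub : ∀ {n t} (f : Subset n) → t < n → sub (insert t ⊥) f ≡ mem f t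
  singleton-sub {t = zero}  (true  ∷ f) _ = ⊥-sub f
  singleton-sub {t = zero}  (false ∷ f) _ = refl
  singleton-sub {t = suc t} (x ∷ f) (s<s p) = singleton-sub f p

  ∑-mem : ∀ {n} (f : Subset n) → ∑ (upTo n) (λ t → [[ mem f t ]]) ≡ ∣ f ∣
  ∑-mem []          = refl
  ∑-mem {suc n} (true  ∷ f) = trans (∑-upTo-suc n (λ t → [[ mem (true ∷ f) t ]])) (cong suc (∑-mem f))
  ∑-mem {suc n} (false ∷ f) = trans (∑-upTo-suc n (λ t → [[ mem (false ∷ f) t ]])) (∑-mem f)

  term≤∑-subsets : ∀ {n} (g : Subset n → ℕ) σ → g σ ≤ ∑ (subsets n) g
  term≤∑-subsets g [] = m≤m+n _ _
  term≤∑-subsets {suc n} g (true ∷ σ) = subst (g (true ∷ σ) ≤_) (sym (∑-++ (map (true ∷_) (subsets n)) _ g))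
    (≤-trans (subst (g (true ∷ σ) ≤_) (sym (∑-map (true ∷_) (subsets n) g)) (term≤∑-subsets (g ∘ (true ∷_)) σ)) (m≤m+n _ _))
  term≤∑-subsets {suc n} g (false ∷ σ) = subst (g (false ∷ σ) ≤_) (sym (∑-++ (map (true ∷_) (subsets n)) _ g))
    (≤-trans (subst (g (false ∷ σ) ≤_) (sym (∑-map (false ∷_) (subsets n) g)) (term≤∑-subsets (g ∘ (false ∷_)) σ)) (m≤n+m _ _))

  ∑-sub : ∀ {n} (f : Subset n) → ∑ (subsets n) (λ σ → [[ sub σ f ]]) ≡ 2 ^ ∣ f ∣
  ∑-sub [] = refl
  ∑-sub {suc n} (y ∷ f) = trans (∑-++ (map (true ∷_) (subsets n)) _ _)
    (trans (cong₂ _+_ (∑-map (true ∷_) (subsets n) _) (∑-map (false ∷_) (subsets n) _)) (lem y))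
    where
    lem : ∀ y → ∑ (subsets n) (λ σ → [[ y ∧ sub σ f ]]) + ∑ (subsets n) (λ σ → [[ sub σ f ]]) ≡ 2 ^ ∣ y ∷ f ∣
    lem true  = trans (cong₂ _+_ (∑-sub f) (∑-sub f)) (cong (2 ^ ∣ f ∣ +_) (sym (+-identityʳ _)))
    lem false = trans (cong₂ _+_ (∑-0 (subsets n)) (∑-sub f)) refl

  -- For empty `f` the value is 0; this is what ends the recursion over the levels.
  ∑-nonempty-sub : ∀ {n} (f : Subset n) → ∑ (subsets n) (λ σ → [[ 1 ≤ᵇ ∣ σ ∣ ]] * [[ sub σ f ]]) ≡ 2 ^ ∣ f ∣ ∸ 1
  ∑-nonempty-sub {n} f = begin
    X                                               ≡⟨ m+n∸n≡m X 1 ⟨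
    X + 1 ∸ 1                                       ≡⟨ cong (λ k → X + k ∸ 1) (∑-empty f) ⟨
    X + ∑ (subsets n) (λ σ → [[ not (1 ≤ᵇ ∣ σ ∣) ]] * [[ sub σ f ]]) ∸ 1
      ≡⟨ cong (_∸ 1) (∑-+ (subsets n) _ _) ⟨
    ∑ (subsets n) (λ σ → [[ 1 ≤ᵇ ∣ σ ∣ ]] * [[ sub σ f ]] + [[ not (1 ≤ᵇ ∣ σ ∣) ]] * [[ sub σ f ]]) ∸ 1
      ≡⟨ cong (_∸ 1) (∑-cong (subsets n) (λ σ → split (1 ≤ᵇ ∣ σ ∣) [[ sub σ f ]])) ⟩
    ∑ (subsets n) (λ σ → [[ sub σ f ]]) ∸ 1         ≡⟨ cong (_∸ 1) (∑-sub f) ⟩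
    2 ^ ∣ f ∣ ∸ 1                                   ∎
    where
    open ≡-Reasoning
    X = ∑ (subsets n) (λ σ → [[ 1 ≤ᵇ ∣ σ ∣ ]] * [[ sub σ f ]])
    split : ∀ c k → [[ c ]] * k + [[ not c ]] * k ≡ k
    split true  k = trans (cong (_+ 0) (*-identityˡ k)) (+-identityʳ k)
    split false k = *-identityˡ k
    ∑-empty : ∀ {n} (f : Subset n) → ∑ (subsets n) (λ σ → [[ not (1 ≤ᵇ ∣ σ ∣) ]] * [[ sub σ f ]]) ≡ 1
    ∑-empty [] = refl
    ∑-empty {suc n} (y ∷ f) = trans (∑-++ (map (true ∷_) (subsets n)) _ _)
      (cong₂ _+_ (trans (∑-map (true ∷_) (subsets n) _) (∑-0 (subsets n)))
                 (trans (∑-map (false ∷_) (subsets n) _) (∑-empty f)))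

  -- Powers, truth values as numbers, codegrees in a multiset

  ^-distrib-* : ∀ j x y → (x * y) ^ j ≡ x ^ j * y ^ j
  ^-distrib-* zero    x y = refl
  ^-distrib-* (suc j) x y = trans (cong (x * y *_) (^-distrib-* j x y)) (interchange x y (x ^ j) (y ^ j))
    where
    interchange : ∀ x y u v → x * y * (u * v) ≡ x * u * (y * v)
    interchange = solve-∀

  T⇒≡ : ∀ {x} → Bool.T x → x ≡ true
  T⇒≡ {true} _ = refl

  ≡⇒T : ∀ {x} → x ≡ true → Bool.T x
  ≡⇒T refl = tt

  ≡ᵇ-true : ∀ {k l} → (k ≡ᵇ l) ≡ true → k ≡ l
  ≡ᵇ-true {k} {l} p = ≡ᵇ⇒≡ k l (≡⇒T p)

  ≢⇒≡ᵇ-false : ∀ {k l} → k ≢ l → (k ≡ᵇ l) ≡ false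
  ≢⇒≡ᵇ-false {k} {l} k≢l with k ≡ᵇ l in eq
  ... | true  = contradiction (≡ᵇ-true eq) k≢l
  ... | false = refl

  [[]]≤1 : ∀ x → [[ x ]] ≤ 1
  [[]]≤1 true  = ≤-refl
  [[]]≤1 false = z≤n

  [[]]*-≤ : ∀ x k → [[ x ]] * k ≤ k
  [[]]*-≤ x k = ≤-trans (*-monoˡ-≤ k ([[]]≤1 x)) (≤-reflexive (*-identityˡ k))

  [[]]-mono : ∀ {x y} → (x ≡ true → y ≡ true) → [[ x ]] ≤ [[ y ]]
  [[]]-mono {false} h = z≤n
  [[]]-mono {true}  h rewrite h refl = ≤-refl

  [[∧]] : ∀ x y → [[ x ∧ y ]] ≡ [[ x ]] * [[ y ]]
  [[∧]] true  y = sym (*-identityˡ _)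
  [[∧]] false y = refl

  ∧-trueˡ : ∀ {x y} → x ∧ y ≡ true → x ≡ true
  ∧-trueˡ {true} _ = refl

  ∧-trueʳ : ∀ {x y} → x ∧ y ≡ true → y ≡ true
  ∧-trueʳ {true} p = p

  codegree : ∀ {n} → List (Subset n) → Subset n → ℕ
  codegree P σ = ∑ P (λ f → [[ sub σ f ]])

  size : {A : Set} → List A → ℕ
  size P = ∑ P (λ _ → 1)

  -- The scan

  State : ℕ → Set
  State n = ℕ → List (Subset n)

  -- Here τ is a / b and inequalities are cleared of denominators: m σ / N bounds
  -- the degree of σ in G, and (2 a / b)^j (m σ / N) is its cap in P j.
  module Algorithm {n : ℕ} (G : List (Subset n)) (ρ a b N K : ℕ) (m : Subset n → ℕ) where

    r : ℕ
    r = suc ρ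

    blocked : ℕ → State n → Subset n → Bool
    blocked j P σ = (1 ≤ᵇ ∣ σ ∣) ∧ ((2 * a) ^ j * m σ <ᵇ 2 * (N * b ^ j * codegree (P j) σ))

    -- A vanishing sum rather than a universal statement: each set that fails this test is later
    -- charged to the same sum.
    free : ℕ → State n → Subset n → Bool
    free j P g = ∑ (subsets n) (λ σ → [[ blocked j P σ ]] * [[ sub σ g ]]) ≡ᵇ 0

    selected : ℕ → State n → ℕ → Subset n → Bool
    selected t P j f = (first f ≡ᵇ t) ∧ free (suc j) P (dropFirst f)

    link : ℕ → State n → ℕ → List (Subset n)
    link t P j = map dropFirst (filterᵇ (selected t P j) (P j))

    linkSize : ℕ → State n → ℕ → ℕ
    linkSize t P j = ∑ (P j) (λ f → [[ selected t P j f ]])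

    -- This is `(b / a)^j`, scaled by `a ^ ρ`. It cancels the factor `(a / b)^j` in the caps, so
    -- that a single threshold serves all levels.
    y : ℕ → ℕ
    y j = b ^ j * a ^ (ρ ∸ j)

    potential : ℕ → State n → ℕ
    potential t P = ∑ (upTo r) (λ j → y j * linkSize t P j)

    step : Bool → ℕ → State n → State n
    step x t P zero    = P 0
    step x t P (suc j) = if x then P (suc j) ++ link t P j else P (suc j)

    start : State n
    start zero    = G
    start (suc _) = []

    run : (ℕ → Bool) → ℕ → State n
    run χ zero    = start
    run χ (suc t) = step (χ t) t (run χ t)

    run-cong : ∀ {χ χ′} t → (∀ s → s < t → χ s ≡ χ′ s) → run χ t ≡ run χ′ t
    run-cong zero    h = refl
    run-cong (suc t) h = cong₂ (λ x → step x t) (h t ≤-refl) (run-cong t (λ s s<t → h s (m<n⇒m<1+n s<t)))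

    ∑-link : ∀ t P j g → ∑ (link t P j) g ≡ ∑ (P j) (λ f → [[ selected t P j f ]] * g (dropFirst f))
    ∑-link t P j g = trans (∑-map dropFirst (filterᵇ (selected t P j) (P j)) g) (∑-filter _ (P j) _)

    ∑-step : ∀ x t P j g → ∑ (step x t P (suc j)) g ≡ ∑ (P (suc j)) g + [[ x ]] * ∑ (link t P j) g
    ∑-step true  t P j g = trans (∑-++ (P (suc j)) _ g) (cong (∑ (P (suc j)) g +_) (sym (*-identityˡ _)))
    ∑-step false t P j g = sym (+-identityʳ _)

    All-link : ∀ {Q R : Subset n → Set} t P j → (∀ f → first f ≡ t → Q f → R (dropFirst f)) →
               All Q (P j) → All R (link t P j)
    All-link t P j h q = All.map⁺ (All.map (λ {f} (qf , sf) → h f (≡ᵇ-true (∧-trueˡ {first f ≡ᵇ t} (T⇒≡ sf))) qf)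
      (All.zip (All.filter⁺ _ q , All.all-filter _ (P j))))

    All-run : (Q : ℕ → Subset n → Set) → All (Q 0) G →
              (∀ j f → first f < n → Q j f → Q (suc j) (dropFirst f)) →
              ∀ χ t → t ≤ n → ∀ j → All (Q j) (run χ t j)
    All-run Q q₀ qs χ zero    _    zero    = q₀
    All-run Q q₀ qs χ zero    _    (suc j) = []
    All-run Q q₀ qs χ (suc t) t<n  zero    = All-run Q q₀ qs χ t (<⇒≤ t<n) 0
    All-run Q q₀ qs χ (suc t) t<n  (suc j) with χ t
    ... | true  = All.++⁺ (All-run Q q₀ qs χ t (<⇒≤ t<n) (suc j))
                    (All-link t (run χ t) j (λ f eq → qs j f (subst (_< n) (sym eq) t<n)) (All-run Q q₀ qs χ t (<⇒≤ t<n) j))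
    ... | false = All-run Q q₀ qs χ t (<⇒≤ t<n) (suc j)

    -- Members of the link of s have first element > s, so once time t is
    -- reached no set with first element t is ever added again.
    ∑-first-stable : ∀ χ k t → k + t ≤ n → ∀ j (p : Subset n → ℕ) →
      ∑ (run χ (k + t) j) (λ f → [[ first f ≡ᵇ t ]] * p f) ≡ ∑ (run χ t j) (λ f → [[ first f ≡ᵇ t ]] * p f)
    ∑-first-stable χ zero    t _ j       p = refl
    ∑-first-stable χ (suc k) t h zero    p = ∑-first-stable χ k t (<⇒≤ h) 0 p
    ∑-first-stable χ (suc k) t h (suc j) p = begin
      ∑ (step (χ s) s P (suc j)) g             ≡⟨ ∑-step (χ s) s P j g ⟩
      ∑ (P (suc j)) g + [[ χ s ]] * ∑ (link s P j) g
        ≡⟨ cong (λ z → ∑ (P (suc j)) g + [[ χ s ]] * z) (trans (∑-link s P j g) (trans (∑-cong (P j) vanish) (∑-0 (P j)))) ⟩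
      ∑ (P (suc j)) g + [[ χ s ]] * 0          ≡⟨ cong (∑ (P (suc j)) g +_) (*-zeroʳ [[ χ s ]]) ⟩
      ∑ (P (suc j)) g + 0                      ≡⟨ +-identityʳ _ ⟩
      ∑ (P (suc j)) g                          ≡⟨ ∑-first-stable χ k t (<⇒≤ h) (suc j) p ⟩
      ∑ (run χ t (suc j)) g                    ∎
      where
      open ≡-Reasoning
      s = k + t
      P = run χ s
      g = λ f → [[ first f ≡ᵇ t ]] * p f
      vanish : ∀ f → [[ selected s P j f ]] * g (dropFirst f) ≡ 0
      vanish f with first f ≡ᵇ s in eq
      ... | false = refl
      ... | true  = trans (cong (λ x → [[ free (suc j) P (dropFirst f) ]] * ([[ x ]] * p (dropFirst f))) (≢⇒≡ᵇ-false {first (dropFirst f)} later))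
                          (*-zeroʳ [[ free (suc j) P (dropFirst f) ]])
        where
        later : first (dropFirst f) ≢ t
        later refl = <-irrefl refl (≤-<-trans (m≤n+m t k)
          (subst (_< first (dropFirst f)) (≡ᵇ-true eq)
            (first<first-dropFirst f (subst (_< n) (sym (≡ᵇ-true eq)) h))))

    codegree-mono : ∀ χ k t j σ → codegree (run χ t j) σ ≤ codegree (run χ (k + t) j) σ
    codegree-mono χ zero    t j       σ = ≤-refl
    codegree-mono χ (suc k) t zero    σ = codegree-mono χ k t 0 σ
    codegree-mono χ (suc k) t (suc j) σ = ≤-trans (codegree-mono χ k t (suc j) σ)
      (≤-trans (m≤m+n _ _) (≤-reflexive (sym (∑-step (χ (k + t)) (k + t) (run χ (k + t)) j _))))

    -- Degrees only grow while the caps stay fixed. Hence a rejection at time `t` can be charged to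
    -- a set that is saturated in the final state.
    blocked-mono : ∀ χ k t j σ → blocked j (run χ t) σ ≡ true → blocked j (run χ (k + t)) σ ≡ true
    blocked-mono χ k t j σ h with 1 ≤ᵇ ∣ σ ∣
    ... | true = T⇒≡ (<⇒<ᵇ (<-≤-trans (<ᵇ⇒< ((2 * a) ^ j * m σ) _ (≡⇒T h))
                   (*-monoʳ-≤ 2 (*-monoʳ-≤ (N * b ^ j) (codegree-mono χ k t j σ)))))

    free⇒unblocked : ∀ j P g σ → free j P g ≡ true → sub σ g ≡ true → blocked j P σ ≡ false
    free⇒unblocked j P g σ h s with blocked j P σ in eq
    ... | false = refl
    ... | true  = contradiction
          (subst (1 ≤_) (≡ᵇ-true {∑ (subsets n) term} h) (subst (_≤ ∑ (subsets n) term) (cong₂ (λ x y → [[ x ]] * [[ y ]]) eq s)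
            (term≤∑-subsets term σ)))
          λ ()
      where
      term = λ σ → [[ blocked j P σ ]] * [[ sub σ g ]]

    module _ (N-bound : ∀ σ → 1 ≤ ∣ σ ∣ → N * codegree G σ ≤ m σ)
             (m-insert : ∀ t σ → t < n → mem σ t ≡ false → 1 ≤ ∣ σ ∣ → b * m (insert t σ) ≤ a * m σ) where

      -- A single step adds at most half of the cap. The degree of `σ` in the link is at most that
      -- of `insert t σ` one level below, whose cap is smaller by `a / b`; the 2 in `(2 a / b)^j`
      -- supplies the half. If `t` is in `σ`, no member of the link contains `σ`.
      codegree-link : ∀ t P j σ → t < n → 1 ≤ ∣ σ ∣ → (∀ τ → 1 ≤ ∣ τ ∣ → N * b ^ j * codegree (P j) τ ≤ (2 * a) ^ j * m τ) →
                      2 * (N * b ^ suc j * codegree (link t P j) σ) ≤ (2 * a) ^ suc j * m σ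
      codegree-link t P j σ t<n σ≥1 cap with mem σ t in eq
      ... | true = ≤-trans (≤-reflexive zero-lhs) z≤n
        where
        none : ∀ f → [[ selected t P j f ]] * [[ sub σ (dropFirst f) ]] ≡ 0
        none f with first f ≡ᵇ t in eq₁ | sub σ (dropFirst f) in eq₂
        ... | false | _     = refl
        ... | true  | false = *-zeroʳ [[ free (suc j) P (dropFirst f) ]]
        ... | true  | true  = contradiction (trans (sym (sub-dropFirst⇒∌first σ f eq₂)) (trans (cong (mem σ) (≡ᵇ-true eq₁)) eq)) λ ()
        zero-lhs : 2 * (N * b ^ suc j * codegree (link t P j) σ) ≡ 0
        zero-lhs = trans (cong (λ z → 2 * (N * b ^ suc j * z)) (trans (∑-link t P j _) (trans (∑-cong (P j) none) (∑-0 (P j)))))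
          (cong (2 *_) (*-zeroʳ (N * b ^ suc j)))
      ... | false = begin
        2 * (N * b ^ suc j * codegree (link t P j) σ)     ≤⟨ *-monoʳ-≤ 2 (*-monoʳ-≤ (N * b ^ suc j) link≤) ⟩
        2 * (N * b ^ suc j * codegree (P j) σ′)           ≡⟨ shuffle₁ N b (b ^ j) (codegree (P j) σ′) ⟩
        2 * b * (N * b ^ j * codegree (P j) σ′)           ≤⟨ *-monoʳ-≤ (2 * b) (cap σ′ (subst (1 ≤_) (sym (∣insert∣ σ t<n eq)) (s≤s z≤n))) ⟩
        2 * b * ((2 * a) ^ j * m σ′)                      ≡⟨ shuffle₂ b ((2 * a) ^ j) (m σ′) ⟩
        2 * (2 * a) ^ j * (b * m σ′)                      ≤⟨ *-monoʳ-≤ (2 * (2 * a) ^ j) (m-insert t σ t<n eq σ≥1) ⟩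
        2 * (2 * a) ^ j * (a * m σ)                       ≡⟨ shuffle₃ a ((2 * a) ^ j) (m σ) ⟩
        (2 * a) ^ suc j * m σ                             ∎
        where
        open ≤-Reasoning
        σ′ = insert t σ
        shuffle₁ : ∀ N b c d → 2 * (N * (b * c) * d) ≡ 2 * b * (N * c * d)
        shuffle₁ = solve-∀
        shuffle₂ : ∀ b c d → 2 * b * (c * d) ≡ 2 * c * (b * d)
        shuffle₂ = solve-∀
        shuffle₃ : ∀ a c d → 2 * c * (a * d) ≡ 2 * a * c * d
        shuffle₃ = solve-∀
        into : ∀ f → [[ selected t P j f ]] * [[ sub σ (dropFirst f) ]] ≤ [[ sub σ′ f ]]
        into f with first f ≡ᵇ t in eq₁ | sub σ (dropFirst f) in eq₂
        ... | false | _     = z≤n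
        ... | true  | false = ≤-trans (≤-reflexive (*-zeroʳ [[ free (suc j) P (dropFirst f) ]])) z≤n
        ... | true  | true  = ≤-trans ([[]]*-≤ (free (suc j) P (dropFirst f)) 1) (≤-reflexive (cong [[_]] (sym
          (subst (λ s → sub (insert s σ) f ≡ true) (≡ᵇ-true eq₁)
            (sub-insert σ f (subst (_< n) (sym (≡ᵇ-true eq₁)) t<n) eq₂)))))
        link≤ : codegree (link t P j) σ ≤ codegree (P j) σ′
        link≤ = ≤-trans (≤-reflexive (∑-link t P j _)) (∑-mono (P j) into)

      -- An unblocked `σ` has at most half of its cap and gains at most the other half; a blocked
      -- `σ` gains nothing, since no selected set leaves a remainder containing it.
      codegree-cap : ∀ χ t → t ≤ n → ∀ j σ → 1 ≤ ∣ σ ∣ → N * b ^ j * codegree (run χ t j) σ ≤ (2 * a) ^ j * m σ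
      codegree-cap χ zero    _   zero    σ σ≥1 = subst₂ _≤_ (cong (_* codegree G σ) (sym (*-identityʳ N))) (sym (*-identityˡ (m σ))) (N-bound σ σ≥1)
      codegree-cap χ zero    _   (suc j) σ σ≥1 = ≤-trans (≤-reflexive (*-zeroʳ (N * b ^ suc j))) z≤n
      codegree-cap χ (suc t) t<n zero    σ σ≥1 = codegree-cap χ t (<⇒≤ t<n) 0 σ σ≥1
      codegree-cap χ (suc t) t<n (suc j) σ σ≥1 = subst (λ z → c * z ≤ M) (sym (∑-step (χ t) t P j _)) bound
        where
        open ≤-Reasoning
        P = run χ t
        c = N * b ^ suc j
        M = (2 * a) ^ suc j * m σ
        old = codegree (P (suc j)) σ
        new = codegree (link t P j) σ
        shuffle : ∀ c o w → 2 * (c * (o + w)) ≡ 2 * (c * o) + 2 * (c * w)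
        shuffle = solve-∀
        bound : c * (old + [[ χ t ]] * new) ≤ M
        bound with blocked (suc j) P σ in eq
        ... | false = *-cancelˡ-≤ 2 (begin
          2 * (c * (old + [[ χ t ]] * new))   ≤⟨ *-monoʳ-≤ 2 (*-monoʳ-≤ c (+-monoʳ-≤ old ([[]]*-≤ (χ t) new))) ⟩
          2 * (c * (old + new))               ≡⟨ shuffle c old new ⟩
          2 * (c * old) + 2 * (c * new)       ≤⟨ +-mono-≤ unblocked (codegree-link t P j σ t<n σ≥1 (codegree-cap χ t (<⇒≤ t<n) j)) ⟩
          M + M                               ≡⟨ cong (M +_) (+-identityʳ M) ⟨
          2 * M                               ∎)
          where
          unblocked : 2 * (c * old) ≤ M
          unblocked = ≮⇒≥ λ lt → contradiction (trans (sym eq) (cong₂ _∧_ (T⇒≡ (≤⇒≤ᵇ σ≥1)) (T⇒≡ (<⇒<ᵇ lt)))) λ ()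
        ... | true = begin
          c * (old + [[ χ t ]] * new)         ≡⟨ cong (λ z → c * (old + [[ χ t ]] * z)) new≡0 ⟩
          c * (old + [[ χ t ]] * 0)           ≡⟨ cong (λ z → c * (old + z)) (*-zeroʳ [[ χ t ]]) ⟩
          c * (old + 0)                       ≡⟨ cong (c *_) (+-identityʳ old) ⟩
          c * old                             ≤⟨ codegree-cap χ t (<⇒≤ t<n) (suc j) σ σ≥1 ⟩
          M                                   ∎
          where
          none : ∀ f → [[ selected t P j f ]] * [[ sub σ (dropFirst f) ]] ≡ 0
          none f with first f ≡ᵇ t | free (suc j) P (dropFirst f) in eq₁ | sub σ (dropFirst f) in eq₂
          ... | false | _     | _     = refl
          ... | true  | false | _     = refl
          ... | true  | true  | false = refl
          ... | true  | true  | true  = contradiction (trans (sym eq) (free⇒unblocked (suc j) P (dropFirst f) σ eq₁ eq₂)) λ ()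
          new≡0 : new ≡ 0
          new≡0 = trans (∑-link t P j _) (trans (∑-cong (P j) none) (∑-0 (P j)))

  -- Counting

  -- The total factor of the recursion over `k` remaining levels, with `2 ^ k ∸ 1` relaxed to
  -- `2 ^ k` except at `k = 0`, where it vanishes.
  growth : ℕ → ℕ
  growth zero    = 0
  growth (suc k) = 2 ^ suc k * (1 + growth k)

  module Counting {n : ℕ} (G : List (Subset n)) (ρ a b N K : ℕ) (m : Subset n → ℕ)
    .{{_ : NonZero a}} .{{_ : NonZero b}} .{{_ : NonZero N}}
    (uniform : All (λ f → ∣ f ∣ ≡ suc ρ) G)
    (N-bound : ∀ σ → 1 ≤ ∣ σ ∣ → N * codegree G σ ≤ m σ)
    (m-insert : ∀ t σ → t < n → mem σ t ≡ false → 1 ≤ ∣ σ ∣ → b * m (insert t σ) ≤ a * m σ)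
    (χ : ℕ → Bool) where

    open Algorithm G ρ a b N K m

    final : State n
    final = run χ n

    run-zero : ∀ t → run χ t 0 ≡ G
    run-zero zero    = refl
    run-zero (suc t) = run-zero t

    linkSizeAt : ℕ → ℕ → ℕ
    linkSizeAt t j = linkSize t (run χ t) j

    ∣member∣ : ∀ j → All (λ f → ∣ f ∣ + j ≡ r) (final j)
    ∣member∣ = All-run (λ j f → ∣ f ∣ + j ≡ r) (All.map (λ eq → trans (+-identityʳ _) eq) uniform)
      (λ j f first<n eq → trans (+-suc ∣ dropFirst f ∣ j) (trans (cong (_+ j) (sym (∣dropFirst∣ f first<n))) eq))
      χ n ≤-refl

    member-nonempty : ∀ k j → suc k + j ≡ r → All (λ f → 1 ≤ ∣ f ∣) (final j)
    member-nonempty k j eq = All.map (λ {f} eq′ → subst (1 ≤_) (+-cancelʳ-≡ j (suc k) ∣ f ∣ (trans eq (sym eq′))) (s≤s z≤n)) (∣member∣ j)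

    size-run : ∀ j k → size (run χ k (suc j)) ≡ ∑ (upTo k) (λ t → [[ χ t ]] * linkSizeAt t j)
    size-run j zero    = refl
    size-run j (suc k) = begin
      size (run χ (suc k) (suc j))                          ≡⟨ ∑-step (χ k) k (run χ k) j _ ⟩
      size (run χ k (suc j)) + [[ χ k ]] * size (link k (run χ k) j)
        ≡⟨ cong₂ (λ x y → x + [[ χ k ]] * y) (size-run j k)
             (trans (∑-link k (run χ k) j _) (∑-cong (run χ k j) (λ f → *-identityʳ _))) ⟩
      ∑ (upTo k) (λ t → [[ χ t ]] * linkSizeAt t j) + [[ χ k ]] * linkSizeAt k j
        ≡⟨ ∑-upTo-∷ʳ k (λ t → [[ χ t ]] * linkSizeAt t j) ⟨
      ∑ (upTo (suc k)) (λ t → [[ χ t ]] * linkSizeAt t j)   ∎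
      where open ≡-Reasoning

    module _ {t : ℕ} (t<n : t < n) where

      private
        n∸t+t≡n : n ∸ t + t ≡ n
        n∸t+t≡n = m∸n+n≡m (<⇒≤ t<n)

      codegree-final : ∀ j σ → codegree (run χ t j) σ ≤ codegree (final j) σ
      codegree-final j σ = subst (λ s → codegree (run χ t j) σ ≤ codegree (run χ s j) σ) n∸t+t≡n (codegree-mono χ (n ∸ t) t j σ)

      blocked-final : ∀ j σ → blocked j (run χ t) σ ≡ true → blocked j final σ ≡ true
      blocked-final j σ h = subst (λ s → blocked j (run χ s) σ ≡ true) n∸t+t≡n (blocked-mono χ (n ∸ t) t j σ h)

      -- Membership is read off at the end and freeness at time `t`: the sets with first element `t`
      -- are already complete when `t` is scanned.
      linkSize-final : ∀ j → ∑ (final j) (λ f → [[ first f ≡ᵇ t ]] * [[ free (suc j) (run χ t) (dropFirst f) ]]) ≡ linkSizeAt t j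
      linkSize-final j = trans
        (subst (λ s → ∑ (run χ s j) (λ f → [[ first f ≡ᵇ t ]] * p f) ≡ ∑ (run χ t j) (λ f → [[ first f ≡ᵇ t ]] * p f))
          n∸t+t≡n (∑-first-stable χ (n ∸ t) t (≤-reflexive n∸t+t≡n) j p))
        (∑-cong (run χ t j) (λ f → sym ([[∧]] (first f ≡ᵇ t) _)))
        where
        p : Subset n → ℕ
        p f = [[ free (suc j) (run χ t) (dropFirst f) ]]

      linkSize≤codegree : ∀ j → linkSizeAt t j ≤ codegree (final j) (insert t ⊥)
      linkSize≤codegree j = ≤-trans (∑-mono (run χ t j) (λ f → [[]]-mono {selected t (run χ t) j f} (contains f))) (codegree-final j (insert t ⊥))
        where
        contains : ∀ f → selected t (run χ t) j f ≡ true → sub (insert t ⊥) f ≡ true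
        contains f h = trans (singleton-sub f t<n) (subst (λ s → mem f s ≡ true) eq (mem-first f (subst (_< n) (sym eq) t<n)))
          where
          eq : first f ≡ t
          eq = ≡ᵇ-true (∧-trueˡ h)

    -- A set with first element `t` is either counted in the link of `t`, whether or not `t` is
    -- chosen, or rejected at time `t` because of a blocked subset, which is then still blocked at
    -- the end.
    size-≤ : ∀ k j → suc k + j ≡ r →
      size (final j) ≤ ∑ (upTo n) (λ t → linkSizeAt t j)
                       + ∑ (subsets n) (λ σ → [[ blocked (suc j) final σ ]] * codegree (final j) σ)
    size-≤ k j eq = begin
      size (final j)
        ≤⟨ ∑-mono-All (All.map (λ {f} → cover f) (member-nonempty k j eq)) ⟩
      ∑ (final j) (λ f → ∑ (upTo n) (λ t → hit f t) + S f)
        ≡⟨ ∑-+ (final j) _ _ ⟩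
      ∑ (final j) (λ f → ∑ (upTo n) (λ t → hit f t)) + ∑ (final j) S
        ≡⟨ cong₂ _+_ (trans (∑-swap (final j) (upTo n) hit) (∑-cong-All (all-upTo n (λ t t<n → linkSize-final t<n j))))
                     (trans (∑-swap (final j) (subsets n) _) (∑-cong (subsets n) (λ σ → ∑-*ˡ [[ blocked (suc j) final σ ]] (final j) (λ f → [[ sub σ f ]])))) ⟩
      ∑ (upTo n) (λ t → linkSizeAt t j) + ∑ (subsets n) (λ σ → [[ blocked (suc j) final σ ]] * codegree (final j) σ) ∎
      where
      open ≤-Reasoning
      hit : Subset n → ℕ → ℕ
      hit f t = [[ first f ≡ᵇ t ]] * [[ free (suc j) (run χ t) (dropFirst f) ]]
      S : Subset n → ℕ
      S f = ∑ (subsets n) (λ σ → [[ blocked (suc j) final σ ]] * [[ sub σ f ]])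
      unfree : ∀ f {t} → t < n → free (suc j) (run χ t) (dropFirst f) ≡ false → 1 ≤ S f
      unfree f {t} t<n h = ≤-trans (n≢0⇒n>0 λ eq → contradiction (trans (sym h) (T⇒≡ (≡⇒≡ᵇ _ 0 eq))) λ ())
        (∑-mono (subsets n) (λ σ → *-mono-≤ ([[]]-mono (blocked-final t<n (suc j) σ)) ([[]]-mono (sub-dropFirst σ f))))
      point : ∀ f t → t < n → [[ first f ≡ᵇ t ]] ≤ hit f t + S f * [[ first f ≡ᵇ t ]]
      point f t t<n with first f ≡ᵇ t | free (suc j) (run χ t) (dropFirst f) in eq
      ... | false | _     = z≤n
      ... | true  | true  = s≤s z≤n
      ... | true  | false = ≤-trans (unfree f t<n eq) (≤-reflexive (sym (*-identityʳ (S f))))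
      cover : ∀ f → 1 ≤ ∣ f ∣ → 1 ≤ ∑ (upTo n) (λ t → hit f t) + S f
      cover f f≥1 = begin
        1                                                      ≡⟨ ∑-point (∣f∣>0⇒first<n f f≥1) ⟨
        ∑ (upTo n) (λ t → [[ first f ≡ᵇ t ]])                  ≤⟨ ∑-mono-All (all-upTo n (point f)) ⟩
        ∑ (upTo n) (λ t → hit f t + S f * [[ first f ≡ᵇ t ]])  ≡⟨ ∑-+ (upTo n) _ _ ⟩
        H + ∑ (upTo n) (λ t → S f * [[ first f ≡ᵇ t ]])        ≡⟨ cong (H +_) (∑-*ˡ (S f) (upTo n) _) ⟩
        H + S f * ∑ (upTo n) (λ t → [[ first f ≡ᵇ t ]])        ≤⟨ +-monoʳ-≤ H (*-monoʳ-≤ (S f) (∑-point-≤ n (first f))) ⟩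
        H + S f * 1                                            ≡⟨ cong (H +_) (*-identityʳ (S f)) ⟩
        H + S f                                                ∎
        where
        H = ∑ (upTo n) (λ t → hit f t)

    cap : ∀ j σ → 1 ≤ ∣ σ ∣ → N * b ^ j * codegree (final j) σ ≤ (2 * a) ^ j * m σ
    cap = codegree-cap N-bound m-insert χ n ≤-refl

    -- The cap bounds the degree one level below from above, saturation bounds the degree on this
    -- level from below, and the two bounds differ by the factor `a / b`.
    blocked-ratio : ∀ j σ → blocked (suc j) final σ ≡ true → a * codegree (final j) σ ≤ b * codegree (final (suc j)) σ
    blocked-ratio j σ h = *-cancelˡ-≤ (2 * (N * b ^ j)) {{m*n≢0 2 (N * b ^ j)}} (begin
      2 * (N * b ^ j) * (a * codegree (final j) σ)     ≡⟨ shuffle₁ a (N * b ^ j) _ ⟩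
      2 * a * (N * b ^ j * codegree (final j) σ)       ≤⟨ *-monoʳ-≤ (2 * a) (cap j σ (≤ᵇ⇒≤ 1 _ (≡⇒T (∧-trueˡ h)))) ⟩
      2 * a * ((2 * a) ^ j * m σ)                      ≡⟨ *-assoc (2 * a) ((2 * a) ^ j) (m σ) ⟨
      (2 * a) ^ suc j * m σ                            ≤⟨ <⇒≤ (<ᵇ⇒< _ _ (≡⇒T (∧-trueʳ {1 ≤ᵇ ∣ σ ∣} h))) ⟩
      2 * (N * b ^ suc j * codegree (final (suc j)) σ) ≡⟨ shuffle₂ N b (b ^ j) _ ⟩
      2 * (N * b ^ j) * (b * codegree (final (suc j)) σ) ∎)
      where
      open ≤-Reasoning
      instance
        b^j≢0 : NonZero (b ^ j)
        b^j≢0 = m^n≢0 b j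
        Nb^j≢0 : NonZero (N * b ^ j)
        Nb^j≢0 = m*n≢0 N (b ^ j)
      shuffle₁ : ∀ a c d → 2 * c * (a * d) ≡ 2 * a * (c * d)
      shuffle₁ = solve-∀
      shuffle₂ : ∀ N b c d → 2 * (N * (b * c) * d) ≡ 2 * (N * c) * (b * d)
      shuffle₂ = solve-∀

    -- By `blocked-ratio` the rejected sets are bounded by degrees in level `j + 1`. Its members
    -- have `k` elements, so each is counted once for each of its `2 ^ k ∸ 1` nonempty subsets.
    level-≤ : ∀ k j → suc k + j ≡ r →
      a * size (final j) ≤ a * ∑ (upTo n) (λ t → linkSizeAt t j) + (2 ^ k ∸ 1) * (b * size (final (suc j)))
    level-≤ k j eq = begin
      a * size (final j)
        ≤⟨ *-monoʳ-≤ a (size-≤ k j eq) ⟩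
      a * (L + ∑ (subsets n) (λ σ → [[ blocked (suc j) final σ ]] * codegree (final j) σ))
        ≡⟨ trans (*-distribˡ-+ a L _) (cong (a * L +_) (sym (∑-*ˡ a (subsets n) _))) ⟩
      a * L + ∑ (subsets n) (λ σ → a * ([[ blocked (suc j) final σ ]] * codegree (final j) σ))
        ≤⟨ +-monoʳ-≤ (a * L) (∑-mono (subsets n) ratio) ⟩
      a * L + ∑ (subsets n) (λ σ → b * ([[ 1 ≤ᵇ ∣ σ ∣ ]] * codegree Q σ))
        ≡⟨ cong (a * L +_) (trans (∑-*ˡ b (subsets n) _) (cong (b *_) total)) ⟩
      a * L + b * ((2 ^ k ∸ 1) * size Q)
        ≡⟨ cong (a * L +_) (swap b (2 ^ k ∸ 1) (size Q)) ⟩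
      a * L + (2 ^ k ∸ 1) * (b * size Q) ∎
      where
      open ≤-Reasoning
      L = ∑ (upTo n) (λ t → linkSizeAt t j)
      Q = final (suc j)
      swap : ∀ x y z → x * (y * z) ≡ y * (x * z)
      swap = solve-∀
      ratio : ∀ σ → a * ([[ blocked (suc j) final σ ]] * codegree (final j) σ) ≤ b * ([[ 1 ≤ᵇ ∣ σ ∣ ]] * codegree Q σ)
      ratio σ with blocked (suc j) final σ in eq
      ... | false = ≤-trans (≤-reflexive (*-zeroʳ a)) z≤n
      ... | true  = subst₂ _≤_ (cong (a *_) (sym (*-identityˡ _)))
                      (cong (b *_) (sym (trans (cong (λ x → [[ x ]] * codegree Q σ) (∧-trueˡ {1 ≤ᵇ ∣ σ ∣} eq)) (*-identityˡ (codegree Q σ)))))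
                      (blocked-ratio j σ eq)
      total : ∑ (subsets n) (λ σ → [[ 1 ≤ᵇ ∣ σ ∣ ]] * codegree Q σ) ≡ (2 ^ k ∸ 1) * size Q
      total = trans (∑-cong (subsets n) (λ σ → sym (∑-*ˡ [[ 1 ≤ᵇ ∣ σ ∣ ]] Q _)))
        (trans (∑-swap (subsets n) Q _)
        (trans (∑-cong-All (All.map (λ {f} eq′ → trans (∑-nonempty-sub f)
            (trans (cong (λ x → 2 ^ x ∸ 1) (+-cancelʳ-≡ (suc j) ∣ f ∣ k (trans eq′ (trans (sym eq) (sym (+-suc k j))))))
                   (sym (*-identityʳ (2 ^ k ∸ 1))))) (∣member∣ (suc j))))
          (∑-*ˡ (2 ^ k ∸ 1) Q _)))

    y-eq : ∀ k j → k + j ≡ ρ → y j ≡ b ^ j * a ^ k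
    y-eq k j refl = cong (λ x → b ^ j * a ^ x) (m+n∸n≡m k j)

    -- The weight on the right of one level inequality is the weight on the left of the next, so the
    -- inequalities chain.
    by≡ay : ∀ k j → suc k + j ≡ ρ → b * y j ≡ a * y (suc j)
    by≡ay k j eq = trans (cong (b *_) (y-eq (suc k) j eq))
      (trans (shuffle a b (b ^ j) (a ^ k)) (cong (a *_) (sym (y-eq k (suc j) (trans (+-suc k j) eq)))))
      where
      shuffle : ∀ a b c d → b * (c * (a * d)) ≡ a * (b * c * d)
      shuffle = solve-∀

    score : ℕ → ℕ
    score t = potential t (run χ t)

    -- The `b ^ j` in `y j` clears the denominator of the cap and the powers of `a` combine to
    -- `a ^ r`. Only `2 ^ j` depends on the level, and `2 ^ r` bounds it.
    ay-cap : ∀ k j σ → k + j ≡ ρ → 1 ≤ ∣ σ ∣ → N * (a * y j) * codegree (final j) σ ≤ 2 ^ r * a ^ r * m σ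
    ay-cap k j σ eq σ≥1 = begin
      N * (a * y j) * codegree (final j) σ               ≡⟨ cong (λ z → N * (a * z) * codegree (final j) σ) (y-eq k j eq) ⟩
      N * (a * (b ^ j * a ^ k)) * codegree (final j) σ   ≡⟨ shuffle₁ N a (b ^ j) (a ^ k) _ ⟩
      a * a ^ k * (N * b ^ j * codegree (final j) σ)     ≤⟨ *-monoʳ-≤ (a * a ^ k) (cap j σ σ≥1) ⟩
      a * a ^ k * ((2 * a) ^ j * m σ)                    ≡⟨ cong (λ z → a * a ^ k * (z * m σ)) (^-distrib-* j 2 a) ⟩
      a * a ^ k * (2 ^ j * a ^ j * m σ)                  ≡⟨ shuffle₂ a (a ^ k) (2 ^ j) (a ^ j) (m σ) ⟩
      2 ^ j * (a * (a ^ k * a ^ j)) * m σ                ≡⟨ cong (λ z → 2 ^ j * (a * z) * m σ) (trans (sym (^-distribˡ-+-* a k j)) (cong (a ^_) eq)) ⟩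
      2 ^ j * a ^ r * m σ                                ≤⟨ *-monoˡ-≤ (m σ) (*-monoˡ-≤ (a ^ r) (^-monoʳ-≤ 2 (≤-trans (m≤n+m j k) (≤-trans (≤-reflexive eq) (n≤1+n ρ))))) ⟩
      2 ^ r * a ^ r * m σ                                ∎
      where
      open ≤-Reasoning
      shuffle₁ : ∀ N a c d e → N * (a * (c * d)) * e ≡ a * d * (N * c * e)
      shuffle₁ = solve-∀
      shuffle₂ : ∀ a d t u v → a * d * (t * u * v) ≡ t * (a * (d * u)) * v
      shuffle₂ = solve-∀

    ∣singleton∣≥1 : ∀ {t} → t < n → 1 ≤ ∣ insert t (⊥ {n}) ∣
    ∣singleton∣≥1 {t} t<n = subst (1 ≤_) (sym (∣insert∣ ⊥ t<n (mem-⊥ n t))) (s≤s z≤n)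


    -- Lower bound for the complement of the container

    module ContainerBound (B : ℕ → Bool) (W : ℕ → ℕ)
      (small : ∀ t → t < n → B t ≡ false → K * score t ≤ W t) where

      mB : ℕ
      mB = ∑ (upTo n) (λ t → [[ B t ]] * m (insert t ⊥))

      -- What the links of all vertices can cost on any one level: vertices of `B` pay their caps,
      -- the others their thresholds `W`.
      R : ℕ
      R = K * (2 ^ r * a ^ r) * mB + N * a * ∑ (upTo n) W

      Y : ℕ → ℕ → ℕ
      Y z j = K * N * z * size (final j)

      links≤R : ∀ k j → k + j ≡ ρ → K * N * (a * y j) * ∑ (upTo n) (λ t → linkSizeAt t j) ≤ R
      links≤R k j eq = begin
        c * ∑ (upTo n) (λ t → linkSizeAt t j)   ≡⟨ ∑-*ˡ c (upTo n) _ ⟨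
        ∑ (upTo n) (λ t → c * linkSizeAt t j)   ≤⟨ ∑-mono-All (all-upTo n point) ⟩
        ∑ (upTo n) (λ t → K * (2 ^ r * a ^ r) * ([[ B t ]] * m (insert t ⊥)) + N * a * W t)
          ≡⟨ trans (∑-+ (upTo n) _ _) (cong₂ _+_ (∑-*ˡ (K * (2 ^ r * a ^ r)) (upTo n) _) (∑-*ˡ (N * a) (upTo n) _)) ⟩
        R                                       ∎
        where
        open ≤-Reasoning
        c = K * N * (a * y j)
        shuffle₁ : ∀ K N a y l → K * N * (a * y) * l ≡ N * a * (K * (y * l))
        shuffle₁ = solve-∀
        shuffle₂ : ∀ K N z l → K * N * z * l ≡ K * (N * z * l)
        shuffle₂ = solve-∀
        shuffle₃ : ∀ K e x → K * (e * x) ≡ K * e * (1 * x)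
        shuffle₃ = solve-∀
        point : ∀ t → t < n → c * linkSizeAt t j ≤ K * (2 ^ r * a ^ r) * ([[ B t ]] * m (insert t ⊥)) + N * a * W t
        point t t<n with B t in Bt
        ... | false = begin
          c * linkSizeAt t j                ≡⟨ shuffle₁ K N a (y j) _ ⟩
          N * a * (K * (y j * linkSizeAt t j))
            ≤⟨ *-monoʳ-≤ (N * a) (≤-trans (*-monoʳ-≤ K (term≤∑-upTo r (λ j → y j * linkSizeAt t j) (s≤s (≤-trans (m≤n+m j k) (≤-reflexive eq))))) (small t t<n Bt)) ⟩
          N * a * W t                       ≤⟨ m≤n+m _ _ ⟩
          K * (2 ^ r * a ^ r) * 0 + N * a * W t ∎
        ... | true  = begin
          c * linkSizeAt t j                          ≤⟨ *-monoʳ-≤ c (linkSize≤codegree t<n j) ⟩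
          c * codegree (final j) (insert t ⊥)         ≡⟨ shuffle₂ K N (a * y j) _ ⟩
          K * (N * (a * y j) * codegree (final j) (insert t ⊥)) ≤⟨ *-monoʳ-≤ K (ay-cap k j _ eq (∣singleton∣≥1 t<n)) ⟩
          K * (2 ^ r * a ^ r * m (insert t ⊥))        ≡⟨ shuffle₃ K (2 ^ r * a ^ r) _ ⟩
          K * (2 ^ r * a ^ r) * (1 * m (insert t ⊥))  ≤⟨ m≤m+n _ _ ⟩
          K * (2 ^ r * a ^ r) * (1 * m (insert t ⊥)) + N * a * W t ∎

      level-bound : ∀ k j → k + j ≡ ρ → Y (a * y j) j ≤ R + (2 ^ k ∸ 1) * Y (b * y j) (suc j)
      level-bound k j eq = begin
        Y (a * y j) j                                   ≡⟨ shuffle₁ K N a (y j) _ ⟩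
        K * N * y j * (a * size (final j))              ≤⟨ *-monoʳ-≤ (K * N * y j) (level-≤ k j (cong suc eq)) ⟩
        K * N * y j * (a * L + (2 ^ k ∸ 1) * (b * size (final (suc j))))
          ≡⟨ shuffle₂ K N a b (y j) L (2 ^ k ∸ 1) _ ⟩
        K * N * (a * y j) * L + (2 ^ k ∸ 1) * Y (b * y j) (suc j)
          ≤⟨ +-monoˡ-≤ _ (links≤R k j eq) ⟩
        R + (2 ^ k ∸ 1) * Y (b * y j) (suc j)           ∎
        where
        open ≤-Reasoning
        L = ∑ (upTo n) (λ t → linkSizeAt t j)
        shuffle₁ : ∀ K N a y s → K * N * (a * y) * s ≡ K * N * y * (a * s)
        shuffle₁ = solve-∀
        shuffle₂ : ∀ K N a b y l e s → K * N * y * (a * l + e * (b * s)) ≡ K * N * (a * y) * l + e * (K * N * (b * y) * s)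
        shuffle₂ = solve-∀

      growth-bound : ∀ k j → k + j ≡ ρ → (2 ^ k ∸ 1) * Y (b * y j) (suc j) ≤ growth k * R
      -- Here `2 ^ 0 ∸ 1` is 0: members of the last level are empty and contain no blocked set, so
      -- the uncontrolled size of `P r` does not enter.
      growth-bound zero    j eq = z≤n
      growth-bound (suc k) j eq = begin
        (2 ^ suc k ∸ 1) * Y (b * y j) (suc j)        ≤⟨ *-monoˡ-≤ (Y (b * y j) (suc j)) (m∸n≤m (2 ^ suc k) 1) ⟩
        2 ^ suc k * Y (b * y j) (suc j)              ≡⟨ cong (λ z → 2 ^ suc k * Y z (suc j)) (by≡ay k j eq) ⟩
        2 ^ suc k * Y (a * y (suc j)) (suc j)        ≤⟨ *-monoʳ-≤ (2 ^ suc k) (level-bound k (suc j) eq′) ⟩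
        2 ^ suc k * (R + (2 ^ k ∸ 1) * Y (b * y (suc j)) (suc (suc j)))
          ≤⟨ *-monoʳ-≤ (2 ^ suc k) (+-monoʳ-≤ R (growth-bound k (suc j) eq′)) ⟩
        2 ^ suc k * (R + growth k * R)               ≡⟨ *-assoc (2 ^ suc k) (1 + growth k) R ⟨
        growth (suc k) * R                           ∎
        where
        open ≤-Reasoning
        eq′ : k + suc j ≡ ρ
        eq′ = trans (+-suc k j) eq

      container-bound : K * N * a ^ r * size G ≤ (1 + growth ρ) * R
      container-bound = begin
        K * N * a ^ r * size G                 ≡⟨ cong₂ (λ z P → K * N * (a * z) * size P) (+-identityʳ (a ^ ρ)) (run-zero n) ⟨
        Y (a * y 0) 0                          ≤⟨ level-bound ρ 0 (+-identityʳ ρ) ⟩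
        R + (2 ^ ρ ∸ 1) * Y (b * y 0) 1        ≤⟨ +-monoʳ-≤ R (growth-bound ρ 0 (+-identityʳ ρ)) ⟩
        R + growth ρ * R                       ∎
        where
        open ≤-Reasoning

    -- Upper bound for the weight of the fingerprint

    module FingerprintBound (W : ℕ → ℕ) (large : ∀ t → t < n → χ t ≡ true → W t ≤ K * score t) where

      score-total : ∑ (upTo n) (λ t → [[ χ t ]] * W t) ≤ K * ∑ (upTo r) (λ j → y j * size (final (suc j)))
      score-total = begin
        ∑ (upTo n) (λ t → [[ χ t ]] * W t)             ≤⟨ ∑-mono-All (all-upTo n point) ⟩
        ∑ (upTo n) (λ t → K * ([[ χ t ]] * score t))   ≡⟨ ∑-*ˡ K (upTo n) _ ⟩
        K * ∑ (upTo n) (λ t → [[ χ t ]] * score t)     ≡⟨ cong (K *_) (∑-cong (upTo n) (λ t → ∑-*ˡ [[ χ t ]] (upTo r) _)) ⟨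
        K * ∑ (upTo n) (λ t → ∑ (upTo r) (λ j → [[ χ t ]] * (y j * linkSizeAt t j)))
          ≡⟨ cong (K *_) (∑-swap (upTo n) (upTo r) _) ⟩
        K * ∑ (upTo r) (λ j → ∑ (upTo n) (λ t → [[ χ t ]] * (y j * linkSizeAt t j)))
          ≡⟨ cong (K *_) (∑-cong (upTo r) level) ⟩
        K * ∑ (upTo r) (λ j → y j * size (final (suc j))) ∎
        where
        open ≤-Reasoning
        swap : ∀ x y z → x * (y * z) ≡ y * (x * z)
        swap = solve-∀
        point : ∀ t → t < n → [[ χ t ]] * W t ≤ K * ([[ χ t ]] * score t)
        point t t<n with χ t in eq
        ... | false = z≤n
        ... | true  = subst₂ _≤_ (sym (*-identityˡ (W t))) (cong (K *_) (sym (*-identityˡ (score t)))) (large t t<n eq)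
        level : ∀ j → ∑ (upTo n) (λ t → [[ χ t ]] * (y j * linkSizeAt t j)) ≡ y j * size (final (suc j))
        level j = trans (∑-cong (upTo n) (λ t → swap [[ χ t ]] (y j) (linkSizeAt t j)))
          (trans (∑-*ˡ (y j) (upTo n) _) (cong (y j *_) (sym (size-run j n))))

      mV : ℕ
      mV = ∑ (upTo n) (λ t → m (insert t ⊥))

      size≤∑codegree : ∀ k j → suc k + j ≡ r → size (final j) ≤ ∑ (upTo n) (λ t → codegree (final j) (insert t ⊥))
      size≤∑codegree k j eq = begin
        size (final j)                                                  ≤⟨ ∑-mono-All (member-nonempty k j eq) ⟩
        ∑ (final j) (λ f → ∣ f ∣)                                       ≡⟨ ∑-cong (final j) ∑-mem ⟨
        ∑ (final j) (λ f → ∑ (upTo n) (λ t → [[ mem f t ]]))            ≡⟨ ∑-swap (final j) (upTo n) _ ⟩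
        ∑ (upTo n) (λ t → ∑ (final j) (λ f → [[ mem f t ]]))
          ≡⟨ ∑-cong-All (all-upTo n (λ t t<n → ∑-cong (final j) (λ f → cong [[_]] (singleton-sub f t<n)))) ⟨
        ∑ (upTo n) (λ t → codegree (final j) (insert t ⊥))              ∎
        where open ≤-Reasoning

      -- Level `j + 1` is at most `ρ`, so its members are nonempty and the caps on single vertices
      -- bound its size. Level `r` consists of empty sets and is kept as a separate term in
      -- `fingerprint-bound`.
      level-cap : ∀ j → j < ρ → N * b * (y j * size (final (suc j))) ≤ 2 ^ r * a ^ r * mV
      level-cap j j<ρ = begin
        N * b * (y j * size (final (suc j)))                 ≡⟨ shuffle N b (y j) _ ⟩
        N * (b * y j) * size (final (suc j))                 ≡⟨ cong (λ z → N * z * size (final (suc j))) (by≡ay k j eq) ⟩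
        N * (a * y (suc j)) * size (final (suc j))           ≤⟨ *-monoʳ-≤ (N * (a * y (suc j))) (size≤∑codegree k (suc j) (cong suc eq′)) ⟩
        N * (a * y (suc j)) * ∑ (upTo n) (λ t → codegree (final (suc j)) (insert t ⊥))
          ≡⟨ ∑-*ˡ (N * (a * y (suc j))) (upTo n) _ ⟨
        ∑ (upTo n) (λ t → N * (a * y (suc j)) * codegree (final (suc j)) (insert t ⊥))
          ≤⟨ ∑-mono-All (all-upTo n (λ t t<n → ay-cap k (suc j) _ eq′ (∣singleton∣≥1 t<n))) ⟩
        ∑ (upTo n) (λ t → 2 ^ r * a ^ r * m (insert t ⊥))    ≡⟨ ∑-*ˡ (2 ^ r * a ^ r) (upTo n) _ ⟩
        2 ^ r * a ^ r * mV                                   ∎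
        where
        open ≤-Reasoning
        shuffle : ∀ N b y s → N * b * (y * s) ≡ N * (b * y) * s
        shuffle = solve-∀
        k = ρ ∸ suc j
        eq′ : k + suc j ≡ ρ
        eq′ = m∸n+n≡m j<ρ
        eq : suc k + j ≡ ρ
        eq = trans (sym (+-suc k j)) eq′

      fingerprint-bound : N * b * ∑ (upTo n) (λ t → [[ χ t ]] * W t)
                          ≤ K * (ρ * (2 ^ r * a ^ r * mV) + N * b * (b ^ ρ * size (final r)))
      fingerprint-bound = begin
        N * b * ∑ (upTo n) (λ t → [[ χ t ]] * W t)           ≤⟨ *-monoʳ-≤ (N * b) score-total ⟩
        N * b * (K * ∑ (upTo r) s)                           ≡⟨ shuffle (N * b) K _ ⟩
        K * (N * b * ∑ (upTo r) s)                           ≡⟨ cong (λ z → K * (N * b * z)) (∑-upTo-∷ʳ ρ s) ⟩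
        K * (N * b * (∑ (upTo ρ) s + s ρ))                   ≡⟨ cong (K *_) (*-distribˡ-+ (N * b) _ _) ⟩
        K * (N * b * ∑ (upTo ρ) s + N * b * s ρ)
          ≡⟨ cong₂ (λ z z′ → K * (z + N * b * (z′ * size (final r)))) (sym (∑-*ˡ (N * b) (upTo ρ) s)) (trans (y-eq 0 ρ refl) (*-identityʳ (b ^ ρ))) ⟩
        K * (∑ (upTo ρ) (λ j → N * b * s j) + N * b * (b ^ ρ * size (final r)))
          ≤⟨ *-monoʳ-≤ K (+-monoˡ-≤ _ (∑-mono-All (all-upTo ρ level-cap))) ⟩
        K * (∑ (upTo ρ) (λ _ → c) + N * b * (b ^ ρ * size (final r)))
          ≡⟨ cong (λ z → K * (z + N * b * (b ^ ρ * size (final r)))) (∑-const ρ c) ⟩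
        K * (ρ * c + N * b * (b ^ ρ * size (final r)))       ∎
        where
        open ≤-Reasoning
        c = 2 ^ r * a ^ r * mV
        s : ℕ → ℕ
        s j = y j * size (final (suc j))
        shuffle : ∀ x y z → x * (y * z) ≡ y * (x * z)
        shuffle = solve-∀

    -- The last level and the edges inside the fingerprint

    module InducedBound (T : Subset n) (χ≡T : ∀ t → t < n → χ t ≡ mem T t) where

      inside : ℕ → ℕ
      inside j = ∑ (final j) (λ f → [[ sub f T ]])

      -- A member of level `j + 1` inside `T` is some `f` of level `j` without its first element,
      -- which is in `T`; so `f` lies inside `T` as well. Each `f` is used at most once, at the time
      -- of its first element, so multiplicities cannot grow.
      inside-suc : ∀ j → inside (suc j) ≤ inside j
      inside-suc j = begin
        inside (suc j)                                                    ≡⟨ inside-run n ⟩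
        ∑ (upTo n) (λ t → [[ χ t ]] * ∑ (run χ t j) (λ f → [[ selected t (run χ t) j f ]] * [[ sub (dropFirst f) T ]]))
          ≤⟨ ∑-mono-All (all-upTo n point) ⟩
        ∑ (upTo n) (λ t → ∑ (final j) (λ f → [[ first f ≡ᵇ t ]] * [[ sub f T ]]))
          ≡⟨ ∑-swap (upTo n) (final j) _ ⟩
        ∑ (final j) (λ f → ∑ (upTo n) (λ t → [[ first f ≡ᵇ t ]] * [[ sub f T ]]))
          ≤⟨ ∑-mono (final j) (λ f → once f) ⟩
        inside j                                                          ∎
        where
        open ≤-Reasoning
        term : ℕ → ℕ
        term t = [[ χ t ]] * ∑ (run χ t j) (λ f → [[ selected t (run χ t) j f ]] * [[ sub (dropFirst f) T ]])
        inside-run : ∀ k → ∑ (run χ k (suc j)) (λ f → [[ sub f T ]]) ≡ ∑ (upTo k) term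
        inside-run zero    = refl
        inside-run (suc k) = trans (∑-step (χ k) k (run χ k) j _)
          (trans (cong₂ (λ x y → x + [[ χ k ]] * y) (inside-run k) (∑-link k (run χ k) j _)) (sym (∑-upTo-∷ʳ k term)))
        point : ∀ t → t < n → term t ≤ ∑ (final j) (λ f → [[ first f ≡ᵇ t ]] * [[ sub f T ]])
        point t t<n with χ t in eq
        ... | false = z≤n
        ... | true  = begin
          1 * ∑ (run χ t j) (λ f → [[ selected t (run χ t) j f ]] * [[ sub (dropFirst f) T ]]) ≡⟨ *-identityˡ _ ⟩
          ∑ (run χ t j) (λ f → [[ selected t (run χ t) j f ]] * [[ sub (dropFirst f) T ]])     ≤⟨ ∑-mono (run χ t j) unfold ⟩
          ∑ (run χ t j) (λ f → [[ first f ≡ᵇ t ]] * [[ sub f T ]])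
            ≡⟨ ∑-first-stable χ (n ∸ t) t (≤-reflexive (m∸n+n≡m (<⇒≤ t<n))) j (λ f → [[ sub f T ]]) ⟨
          ∑ (run χ (n ∸ t + t) j) (λ f → [[ first f ≡ᵇ t ]] * [[ sub f T ]])
            ≡⟨ cong (λ s → ∑ (run χ s j) (λ f → [[ first f ≡ᵇ t ]] * [[ sub f T ]])) (m∸n+n≡m (<⇒≤ t<n)) ⟩
          ∑ (final j) (λ f → [[ first f ≡ᵇ t ]] * [[ sub f T ]]) ∎
          where
          unfold : ∀ f → [[ selected t (run χ t) j f ]] * [[ sub (dropFirst f) T ]] ≤ [[ first f ≡ᵇ t ]] * [[ sub f T ]]
          unfold f with first f ≡ᵇ t in eq₁
          ... | false = z≤n
          ... | true  = ≤-trans ([[]]*-≤ (free (suc j) (run χ t) (dropFirst f)) _)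
            (≤-trans ([[]]-mono (sub-unfold f T (subst (_< n) (sym first≡t) t<n)
                (trans (cong (mem T) first≡t) (trans (sym (χ≡T t t<n)) eq))))
              (≤-reflexive (sym (*-identityˡ _))))
            where
            first≡t : first f ≡ t
            first≡t = ≡ᵇ-true eq₁
        once : ∀ f → ∑ (upTo n) (λ t → [[ first f ≡ᵇ t ]] * [[ sub f T ]]) ≤ [[ sub f T ]]
        once f = begin
          ∑ (upTo n) (λ t → [[ first f ≡ᵇ t ]] * [[ sub f T ]]) ≡⟨ ∑-cong (upTo n) (λ t → *-comm [[ first f ≡ᵇ t ]] _) ⟩
          ∑ (upTo n) (λ t → [[ sub f T ]] * [[ first f ≡ᵇ t ]]) ≡⟨ ∑-*ˡ [[ sub f T ]] (upTo n) _ ⟩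
          [[ sub f T ]] * ∑ (upTo n) (λ t → [[ first f ≡ᵇ t ]]) ≤⟨ *-monoʳ-≤ [[ sub f T ]] (∑-point-≤ n (first f)) ⟩
          [[ sub f T ]] * 1                                     ≡⟨ *-identityʳ _ ⟩
          [[ sub f T ]]                                         ∎

      induced-bound : size (final r) ≤ ∑ G (λ f → [[ sub f T ]])
      induced-bound = begin
        size (final r)               ≡⟨ ∑-cong-All (All.map (λ {f} eq → cong [[_]] (sym (empty-sub f (+-cancelʳ-≡ r ∣ f ∣ 0 eq)))) (∣member∣ r)) ⟩
        inside r                     ≤⟨ descend r ⟩
        inside 0                     ≡⟨ cong (λ P → ∑ P (λ f → [[ sub f T ]])) (run-zero n) ⟩
        ∑ G (λ f → [[ sub f T ]])    ∎
        where
        open ≤-Reasoning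
        descend : ∀ j → inside j ≤ inside 0
        descend zero    = ≤-refl
        descend (suc j) = ≤-trans (inside-suc j) (descend j)
        empty-sub : ∀ {n} (f : Subset n) {T : Subset n} → ∣ f ∣ ≡ 0 → sub f T ≡ true
        empty-sub []          {[]}    _  = refl
        empty-sub (false ∷ f) {x ∷ T} eq = empty-sub f eq

  fromPred : ∀ n → (ℕ → Bool) → Subset n
  fromPred n g = tabulate (g ∘ toℕ)

  mem-fromPred : ∀ {n t} g → t < n → mem (fromPred n g) t ≡ g t
  mem-fromPred {suc n} {zero}  g _       = refl
  mem-fromPred {suc n} {suc t} g (s<s p) = mem-fromPred (g ∘ suc) p

  sub⇒∣∣≤ : ∀ {n} (σ f : Subset n) → sub σ f ≡ true → ∣ σ ∣ ≤ ∣ f ∣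
  sub⇒∣∣≤ []          []          _ = z≤n
  sub⇒∣∣≤ (true  ∷ σ) (true  ∷ f) s = s≤s (sub⇒∣∣≤ σ f s)
  sub⇒∣∣≤ (false ∷ σ) (true  ∷ f) s = m≤n⇒m≤1+n (sub⇒∣∣≤ σ f s)
  sub⇒∣∣≤ (false ∷ σ) (false ∷ f) s = sub⇒∣∣≤ σ f s

  -- Choice of the constants

  weight : {n : ℕ} → (ℕ → ℕ) → Subset n → ℕ
  weight {n} g S = ∑ (upTo n) (λ t → [[ mem S t ]] * g t)

  degreeAt : ∀ {n} → List (Subset n) → ℕ → ℕ
  degreeAt G t = ∑ G (λ f → [[ mem f t ]])

  totalDegree : ∀ {n} → List (Subset n) → ℕ
  totalDegree {n} G = ∑ (upTo n) (degreeAt G)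

  totalDegree-uniform : ∀ {n r} (G : List (Subset n)) → All (λ f → ∣ f ∣ ≡ r) G → totalDegree G ≡ r * size G
  totalDegree-uniform {n} {r} G u = trans (∑-swap (upTo n) G _)
    (trans (∑-cong-All (All.map (λ {f} eq → trans (∑-mem f) (trans eq (sym (*-identityʳ r)))) u)) (∑-*ˡ r G _))

  -- Here r = ρ + 1.  The complement of the container has measure at least 1 / E,
  -- the scan is run with τ / Δ in place of τ, and c = 1 / Z.
  record Constants (ρ : ℕ) : Set where
    field
      E κ Δ Z : ℕ
      E-def : E ≡ 6 * (suc ρ * ((1 + growth ρ) * 2 ^ suc ρ))
      κ-def : κ ≡ suc ρ * (2 * 2 ^ suc ρ)
      Δ-def : Δ ≡ 4 * (E * E * κ)
      Z-def : Z ≡ E * (2 * Δ ^ suc ρ)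

    κ>0 : 0 < κ
    κ>0 = subst (0 <_) (sym κ-def) (*-mono-≤ (s≤s (z≤n {ρ})) (*-mono-≤ (s≤s (z≤n {1})) (m^n>0 2 (suc ρ))))

    E>0 : 0 < E
    E>0 = subst (0 <_) (sym E-def) (*-mono-≤ (s≤s (z≤n {5}))
      (*-mono-≤ (s≤s (z≤n {ρ})) (*-mono-≤ (s≤s (z≤n {growth ρ})) (m^n>0 2 (suc ρ)))))

    Δ>0 : 0 < Δ
    Δ>0 = subst (0 <_) (sym Δ-def) (*-mono-≤ (s≤s (z≤n {3})) (*-mono-≤ (*-mono-≤ E>0 E>0) κ>0))

    Z>0 : 0 < Z
    Z>0 = subst (0 <_) (sym Z-def) (*-mono-≤ E>0 (*-mono-≤ (s≤s (z≤n {1})) (m^n>0 Δ {{>-nonZero Δ>0}} (suc ρ))))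

    -- Needed for the codegree condition, for degenerate sets (`k = ρ`, with the full factor
    -- `2 * E`) and for sets with few edges (`k = suc ρ`).
    Z-split : ∀ k → k ≤ suc ρ → 2 * E * Δ ^ k ≤ Z
    Z-split k k≤r = ≤-trans (*-monoʳ-≤ (2 * E) (^-monoʳ-≤ Δ {{>-nonZero Δ>0}} k≤r))
      (≤-reflexive (trans (shuffle E (Δ ^ suc ρ)) (sym Z-def)))
      where
      shuffle : ∀ x y → 2 * x * y ≡ x * (2 * y)
      shuffle = solve-∀

  constants : ∀ ρ → Constants ρ
  constants ρ = record { E-def = refl ; κ-def = refl ; Δ-def = refl ; Z-def = refl }

  -- Containers and fingerprints for `τ = p / q`

  module Containers {n : ℕ} .{{_ : NonZero n}} (G : List (Subset n)) {ρ : ℕ} (cst : Constants ρ) (p q : ℕ)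
    .{{_ : NonZero p}} .{{_ : NonZero q}} .{{_ : NonZero (size G)}} (uniform : All (λ f → ∣ f ∣ ≡ suc ρ) G) where

    open Constants cst

    private instance
      E≢0 : NonZero E
      E≢0 = >-nonZero E>0
      Δ≢0 : NonZero Δ
      Δ≢0 = >-nonZero Δ>0

    -- The factor `b ^ n` of `N` is a common denominator: `m-insert` concerns sets of every size up
    -- to `n`, so all powers of `a / b` below the `n`-th must be cleared. `K` clears the
    -- denominators `n` and `E` of the threshold.
    a b N K D ε : ℕ
    a = p
    b = Δ * q
    N = E * n * b ^ n
    K = n * E
    D = totalDegree G
    ε = size G

    private instance
      b≢0 : NonZero b
      b≢0 = m*n≢0 Δ q
      b^n≢0 : NonZero (b ^ n)
      b^n≢0 = m^n≢0 b n
      En≢0 : NonZero (E * n)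
      En≢0 = m*n≢0 E n
      N≢0 : NonZero N
      N≢0 = m*n≢0 (E * n) (b ^ n)

    -- With d = D / n: m σ / N is (d / E) (a / b)^(∣ σ ∣ - 1), plus the degree of σ
    -- if σ is a singleton.
    m : Subset n → ℕ
    m σ = D * (a ^ (∣ σ ∣ ∸ 1) * b ^ (n ∸ (∣ σ ∣ ∸ 1))) + (if ∣ σ ∣ ≡ᵇ 1 then N * codegree G σ else 0)

    open Algorithm G ρ a b N K m public

    w : ℕ → ℕ
    w t = n * degreeAt G t + D

    -- The links of t, weighted by (b / a)^j, sum to more than (d(t) + d) / E.
    large : ℕ → State n → Bool
    large t P = a ^ ρ * w t <ᵇ K * potential t P

    container : Subset n → Subset n
    container T = fromPred n (λ t → mem T t ∨ not (large t (run (mem T) t)))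

    container-online : ∀ T T′ t → t < n → (∀ s → s ≤ t → mem T s ≡ mem T′ s) → mem (container T) t ≡ mem (container T′) t
    container-online T T′ t t<n agree = trans (mem-fromPred _ t<n) (trans
      (cong₂ (λ x P → x ∨ not (large t P)) (agree t ≤-refl) (run-cong t (λ s s<t → agree s (<⇒≤ s<t))))
      (sym (mem-fromPred _ t<n)))

    -- `T` is to be chosen by tests on the run driven by `T` itself. Building state and choice
    -- together removes the circularity, and `run-fingerprint` shows that `container`, which sees
    -- only `T`, meets the same states.
    runWithin : Subset n → ℕ → State n
    runWithin I zero    = start
    runWithin I (suc t) = step (mem I t ∧ large t (runWithin I t)) t (runWithin I t)

    fingerprint : Subset n → Subset n
    fingerprint I = fromPred n (λ t → mem I t ∧ large t (runWithin I t))

    run-fingerprint : ∀ I t → t ≤ n → run (mem (fingerprint I)) t ≡ runWithin I t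
    run-fingerprint I zero    _   = refl
    run-fingerprint I (suc t) t<n = cong₂ (λ x → step x t) (mem-fromPred _ t<n) (run-fingerprint I t (<⇒≤ t<n))

    mem-fingerprint : ∀ I t → t < n → mem (fingerprint I) t ≡ mem I t ∧ large t (run (mem (fingerprint I)) t)
    mem-fingerprint I t t<n = trans (mem-fromPred _ t<n) (cong (λ P → mem I t ∧ large t P) (sym (run-fingerprint I t (<⇒≤ t<n))))

    fingerprint⊆ : ∀ I t → t < n → mem (fingerprint I) t ≡ true → mem I t ≡ true
    fingerprint⊆ I t t<n h = ∧-trueˡ (trans (sym (mem-fingerprint I t t<n)) h)

    -- A vertex of `I` left out of `T` failed the test `large`, and failing that test puts it in the
    -- container.
    ⊆container : ∀ I t → t < n → mem I t ≡ true → mem (container (fingerprint I)) t ≡ true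
    ⊆container I t t<n h = trans (mem-fromPred _ t<n) (trans
      (cong (_∨ not L) (trans (mem-fingerprint I t t<n) (cong (_∧ L) h))) (excluded-middle L))
      where
      L = large t (run (mem (fingerprint I)) t)
      excluded-middle : ∀ x → (true ∧ x) ∨ not x ≡ true
      excluded-middle true  = refl
      excluded-middle false = refl

    D≡rε : D ≡ suc ρ * ε
    D≡rε = totalDegree-uniform G uniform

    ε≤D : ε ≤ D
    ε≤D = subst (ε ≤_) (sym D≡rε) (m≤m+n ε (ρ * ε))

    private instance
      D≢0 : NonZero D
      D≢0 = subst NonZero (sym D≡rε) (m*n≢0 (suc ρ) ε)

    m-singleton : ∀ t → t < n → m (insert t ⊥) ≡ b ^ n * (D + E * n * degreeAt G t)
    m-singleton t t<n rewrite trans (∣insert∣ (⊥ {n}) t<n (mem-⊥ n t)) (cong suc (∣⊥∣≡0 n)) =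
      trans (cong (λ z → D * (1 * b ^ n) + N * z) (∑-cong G (λ f → cong [[_]] (singleton-sub f t<n))))
        (shuffle D (b ^ n) (E * n) (degreeAt G t))
      where
      shuffle : ∀ D c x d → D * (1 * c) + x * c * d ≡ c * (D + x * d)
      shuffle = solve-∀

    module _ (sparse : ∀ σ → 2 ≤ ∣ σ ∣ → codegree G σ * (Z * n * q ^ (∣ σ ∣ ∸ 1)) ≤ D * p ^ (∣ σ ∣ ∸ 1)) where

      -- For singletons the second summand of `m` is the degree itself. For larger sets the constant
      -- `1 / Z` makes up for `E` and for the powers of `Δ` lost in `a / b`.
      N-bound : ∀ σ → 1 ≤ ∣ σ ∣ → N * codegree G σ ≤ m σ
      N-bound σ σ≥1 with ∣ σ ∣ in eq
      ... | suc zero    = m≤n+m _ _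
      ... | suc (suc l) = ≤-trans bound (m≤m+n _ 0)
        where
        open ≤-Reasoning
        k = suc l
        c = codegree G σ
        k≤n : k ≤ n
        k≤n = ≤-trans (n≤1+n k) (subst (_≤ n) eq (∣p∣≤n σ))
        b^k : b ^ n ≡ Δ ^ k * q ^ k * b ^ (n ∸ k)
        b^k = trans (cong (b ^_) (sym (m+[n∸m]≡n k≤n))) (trans (^-distribˡ-+-* b k (n ∸ k)) (cong (_* b ^ (n ∸ k)) (^-distrib-* k Δ q)))
        shuffle : ∀ E n d u v c → E * n * (d * u * v) * c ≡ E * d * (c * (n * u)) * v
        shuffle = solve-∀
        shuffle′ : ∀ Z n u c → Z * (c * (n * u)) ≡ c * (Z * n * u)
        shuffle′ = solve-∀
        absent : ∀ f → ∣ f ∣ ≡ suc ρ → suc ρ < ∣ σ ∣ → [[ sub σ f ]] ≡ 0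
        absent f ∣f∣ r<σ with sub σ f in s
        ... | false = refl
        ... | true  = contradiction (subst (∣ σ ∣ ≤_) ∣f∣ (sub⇒∣∣≤ σ f s)) (<⇒≱ r<σ)
        bound : N * c ≤ D * (a ^ k * b ^ (n ∸ k))
        bound with suc ρ <? ∣ σ ∣
        -- `Z-split` stops at exponent `r`, but a set with more than `r` elements lies in no edge.
        ... | yes r<σ = ≤-trans (≤-reflexive (trans (cong (N *_) (trans (∑-cong-All (All.map (λ {f} u → absent f u r<σ) uniform)) (∑-0 G))) (*-zeroʳ N))) z≤n
        ... | no  r≮σ = begin
          E * n * b ^ n * c                                ≡⟨ cong (λ z → E * n * z * c) b^k ⟩
          E * n * (Δ ^ k * q ^ k * b ^ (n ∸ k)) * c        ≡⟨ shuffle E n (Δ ^ k) (q ^ k) _ c ⟩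
          E * Δ ^ k * (c * (n * q ^ k)) * b ^ (n ∸ k)      ≤⟨ *-monoˡ-≤ (b ^ (n ∸ k)) (*-monoˡ-≤ (c * (n * q ^ k)) EΔ^k≤Z) ⟩
          Z * (c * (n * q ^ k)) * b ^ (n ∸ k)              ≡⟨ cong (_* b ^ (n ∸ k)) (shuffle′ Z n (q ^ k) c) ⟩
          c * (Z * n * q ^ k) * b ^ (n ∸ k)                ≤⟨ *-monoˡ-≤ (b ^ (n ∸ k)) (subst (λ s → c * (Z * n * q ^ (s ∸ 1)) ≤ D * p ^ (s ∸ 1)) eq (sparse σ (subst (2 ≤_) (sym eq) (s≤s (s≤s z≤n))))) ⟩
          D * a ^ k * b ^ (n ∸ k)                          ≡⟨ *-assoc D (a ^ k) (b ^ (n ∸ k)) ⟩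
          D * (a ^ k * b ^ (n ∸ k))                        ∎
          where
          EΔ^k≤Z : E * Δ ^ k ≤ Z
          EΔ^k≤Z = ≤-trans (*-monoˡ-≤ (Δ ^ k) (m≤m+n E _)) (Z-split k (≤-trans (n≤1+n k) (subst (_≤ suc ρ) eq (≮⇒≥ r≮σ))))

      -- The flat parts agree exactly. The extra degree term occurs only for singletons, hence only
      -- on the right, `insert t σ` having at least two elements.
      m-insert : ∀ t σ → t < n → mem σ t ≡ false → 1 ≤ ∣ σ ∣ → b * m (insert t σ) ≤ a * m σ
      m-insert t σ t<n t∉σ σ≥1 rewrite ∣insert∣ σ t<n t∉σ with ∣ σ ∣ in eq
      ... | suc k = begin
        b * (D * (a ^ suc k * b ^ (n ∸ suc k)) + 0)   ≡⟨ shuffle a b D (a ^ k) _ ⟩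
        a * (D * (a ^ k * b ^ suc (n ∸ suc k)))       ≡⟨ cong (λ z → a * (D * (a ^ k * b ^ z))) (+-∸-assoc 1 k<n) ⟨
        a * (D * (a ^ k * b ^ (n ∸ k)))               ≤⟨ *-monoʳ-≤ a (m≤m+n _ _) ⟩
        a * (D * (a ^ k * b ^ (n ∸ k)) + _)           ∎
        where
        open ≤-Reasoning
        k<n : k < n
        k<n = subst (_≤ n) eq (∣p∣≤n σ)
        shuffle : ∀ a b D u v → b * (D * (a * u * v) + 0) ≡ a * (D * (u * (b * v)))
        shuffle = solve-∀

      module ForSet (I : Subset n) where

        T : Subset n
        T = fingerprint I

        open Counting G ρ a b N K m uniform N-bound m-insert (mem T) public

        d : ℕ → ℕ
        d = degreeAt G

        -- The complement of the container together with `T`: the vertices whose links need not be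
        -- below the threshold.
        outside : ℕ → Bool
        outside t = mem T t ∨ large t (run (mem T) t)

        wT dB dC : ℕ
        wT = n * weight d T + D * ∣ T ∣
        dB = ∑ (upTo n) (λ t → [[ outside t ]] * d t)
        dC = weight d (container T)

        ∑-selected-w : ∑ (upTo n) (λ t → [[ mem T t ]] * (a ^ ρ * w t)) ≡ a ^ ρ * wT
        ∑-selected-w = trans (∑-cong (upTo n) (λ t → shuffle [[ mem T t ]] (a ^ ρ) n (d t) D))
          (trans (∑-*ˡ (a ^ ρ) (upTo n) _) (cong (a ^ ρ *_) (trans (∑-+ (upTo n) _ _)
            (cong₂ _+_ (∑-*ˡ n (upTo n) _) (trans (∑-*ˡ D (upTo n) _) (cong (D *_) (∑-mem T)))))))
          where
          shuffle : ∀ x c n d D → x * (c * (n * d + D)) ≡ c * (n * (x * d) + D * x)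
          shuffle = solve-∀

        ∑-w : ∑ (upTo n) (λ t → a ^ ρ * w t) ≡ a ^ ρ * (2 * (n * D))
        ∑-w = trans (∑-*ˡ (a ^ ρ) (upTo n) _) (cong (a ^ ρ *_) (trans (∑-+ (upTo n) _ _)
          (trans (cong₂ _+_ (∑-*ˡ n (upTo n) _) (∑-const n D)) (cong (n * D +_) (sym (+-identityʳ (n * D)))))))

        -- With `M = (1 + growth ρ) * 2 ^ r`, `E` is `6 * r * M`, so the left side of
        -- `container-bound` becomes `6 * M * D`. Flat parts contribute at most `D` and thresholds
        -- `2 * D` on the right, up to the factor `M`; half of `6 * D` pays for them and the other
        -- half is left for `dB`.
        container-degree : 3 * D ≤ E * dB
        container-degree = +-cancelʳ-≤ (3 * D) (3 * D) (E * dB) (*-cancelˡ-≤ M (begin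
          M * (3 * D + 3 * D)                      ≡⟨ cong (λ z → M * (3 * z + 3 * z)) D≡rε ⟩
          M * (3 * (suc ρ * ε) + 3 * (suc ρ * ε))  ≡⟨ shuffle₁ M (suc ρ) ε ⟩
          6 * (suc ρ * M) * ε                      ≡⟨ cong (_* ε) E-def ⟨
          E * ε                                    ≤⟨ *-cancelˡ-≤ (E * n * (n * (b ^ n * a ^ r))) scaled ⟩
          A * (2 ^ r * (D + E * dB) + 2 * D)       ≤⟨ *-monoʳ-≤ A (+-monoʳ-≤ _ 2D≤) ⟩
          A * (2 ^ r * (D + E * dB) + 2 ^ r * (2 * D)) ≡⟨ shuffle₂ A (2 ^ r) D (E * dB) ⟩
          M * (E * dB + 3 * D)                     ∎))
          where
          open ≤-Reasoning
          A M : ℕ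
          A = 1 + growth ρ
          M = A * 2 ^ suc ρ
          instance
            2^r≢0 : NonZero (2 ^ r)
            2^r≢0 = m^n≢0 2 r
            a^r≢0 : NonZero (a ^ r)
            a^r≢0 = m^n≢0 a r
            M≢0 : NonZero M
            M≢0 = m*n≢0 A (2 ^ r)
            b^na^r≢0 : NonZero (b ^ n * a ^ r)
            b^na^r≢0 = m*n≢0 (b ^ n) (a ^ r)
            nb^na^r≢0 : NonZero (n * (b ^ n * a ^ r))
            nb^na^r≢0 = m*n≢0 n (b ^ n * a ^ r)
            scale≢0 : NonZero (E * n * (n * (b ^ n * a ^ r)))
            scale≢0 = m*n≢0 (E * n) (n * (b ^ n * a ^ r))
          2D≤ : 2 * D ≤ 2 ^ r * (2 * D)
          2D≤ = m≤n*m (2 * D) (2 ^ r)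
          shuffle₁ : ∀ M r e → M * (3 * (r * e) + 3 * (r * e)) ≡ 6 * (r * M) * e
          shuffle₁ = solve-∀
          shuffle₂ : ∀ A t D x → A * (t * (D + x) + t * (2 * D)) ≡ A * t * (x + 3 * D)
          shuffle₂ = solve-∀
          small : ∀ t → t < n → outside t ≡ false → K * score t ≤ a ^ ρ * w t
          small t t<n h with mem T t | large t (run (mem T) t) in eq
          ... | false | false = ≮⇒≥ λ lt → contradiction (trans (sym eq) (T⇒≡ (<⇒<ᵇ lt))) λ ()
          open ContainerBound outside (λ t → a ^ ρ * w t) small
          mB≤ : mB ≤ b ^ n * n * (D + E * dB)
          mB≤ = begin
            mB
              ≡⟨ ∑-cong-All (all-upTo n (λ t t<n → trans (cong ([[ outside t ]] *_) (m-singleton t t<n)) (shuffle₃ [[ outside t ]] (b ^ n) D (E * n) (d t)))) ⟩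
            ∑ (upTo n) (λ t → b ^ n * (D * [[ outside t ]] + E * n * ([[ outside t ]] * d t)))
              ≡⟨ trans (∑-*ˡ (b ^ n) (upTo n) _) (cong (b ^ n *_) (trans (∑-+ (upTo n) _ _) (cong₂ _+_ (∑-*ˡ D (upTo n) _) (∑-*ˡ (E * n) (upTo n) _)))) ⟩
            b ^ n * (D * ∑ (upTo n) (λ t → [[ outside t ]]) + E * n * dB)
              -- Estimating the number of outside vertices by `n` is affordable, since the flat part
              -- carries the factor `1 / E`.
              ≤⟨ *-monoʳ-≤ (b ^ n) (+-monoˡ-≤ _ (*-monoʳ-≤ D (≤-trans (∑-mono (upTo n) (λ t → [[]]≤1 (outside t))) (≤-reflexive (trans (∑-const n 1) (*-identityʳ n)))))) ⟩
            b ^ n * (D * n + E * n * dB)  ≡⟨ shuffle₄ (b ^ n) D n E dB ⟩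
            b ^ n * n * (D + E * dB)      ∎
            where
            shuffle₃ : ∀ x c D z d → x * (c * (D + z * d)) ≡ c * (D * x + z * (x * d))
            shuffle₃ = solve-∀
            shuffle₄ : ∀ c D n E x → c * (D * n + E * n * x) ≡ c * n * (D + E * x)
            shuffle₄ = solve-∀
          scaled : E * n * (n * (b ^ n * a ^ r)) * (E * ε) ≤ E * n * (n * (b ^ n * a ^ r)) * (A * (2 ^ r * (D + E * dB) + 2 * D))
          scaled = begin
            E * n * (n * (b ^ n * a ^ r)) * (E * ε)  ≡⟨ shuffle₅ E n (b ^ n) (a ^ r) ε ⟩
            K * N * a ^ r * ε                        ≤⟨ container-bound ⟩
            A * R                                    ≤⟨ *-monoʳ-≤ A (+-mono-≤ (*-monoʳ-≤ (K * (2 ^ r * a ^ r)) mB≤) (≤-reflexive (cong (N * a *_) ∑-w))) ⟩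
            A * (K * (2 ^ r * a ^ r) * (b ^ n * n * (D + E * dB)) + N * a * (a ^ ρ * (2 * (n * D))))
              ≡⟨ shuffle₆ A n E (2 ^ r) a (a ^ ρ) (b ^ n) D (E * dB) ⟩
            E * n * (n * (b ^ n * a ^ r)) * (A * (2 ^ r * (D + E * dB) + 2 * D)) ∎
            where
            shuffle₅ : ∀ E n c u e → E * n * (n * (c * u)) * (E * e) ≡ n * E * (E * n * c) * u * e
            shuffle₅ = solve-∀
            shuffle₆ : ∀ A n E t a u c D x → A * (n * E * (t * (a * u)) * (c * n * (D + x)) + E * n * c * a * (u * (2 * (n * D))))
                       ≡ E * n * (n * (c * (a * u))) * (A * (t * (D + x) + 2 * D))
            shuffle₆ = solve-∀

        -- `κ` collects the `r` levels, the `2 ^ r` of the caps and `1 + E ≤ 2 * E`. The 2 in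
        -- `2 * κ` is for the second case, where half of the left side is absorbed.
        fingerprint-weight : b ^ r * size (final r) ≤ a ^ r * D ⊎ 2 * E * n * b ^ ρ * size (final r) ≤ a ^ ρ * D * ∣ T ∣ →
                             b * wT ≤ n * E * (2 * κ) * a * D
        fingerprint-weight h = *-cancelˡ-≤ (a ^ ρ) (weigh h)
          where
          open ≤-Reasoning
          instance
            a^ρ≢0 : NonZero (a ^ ρ)
            a^ρ≢0 = m^n≢0 a ρ
          s c : ℕ
          s = size (final r)
          c = 2 ^ r
          isLarge : ∀ t → t < n → mem T t ≡ true → a ^ ρ * w t ≤ K * score t
          isLarge t t<n h = <⇒≤ (<ᵇ⇒< (a ^ ρ * w t) _ (≡⇒T (∧-trueʳ {mem I t} (trans (sym (mem-fingerprint I t t<n)) h))))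
          open FingerprintBound (λ t → a ^ ρ * w t) isLarge
          mV≡ : mV ≡ b ^ n * n * (1 + E) * D
          mV≡ = trans (∑-cong-All (all-upTo n m-singleton)) (trans (∑-*ˡ (b ^ n) (upTo n) _)
            (trans (cong (b ^ n *_) (trans (∑-+ (upTo n) _ _) (cong₂ _+_ (∑-const n D) (∑-*ˡ (E * n) (upTo n) _))))
              (shuffle (b ^ n) n D E)))
            where
            shuffle : ∀ c n D E → c * (n * D + E * n * D) ≡ c * n * (1 + E) * D
            shuffle = solve-∀
          base : a ^ ρ * (b * wT) ≤ n * (ρ * c * a ^ r * (1 + E) * D + E * b ^ r * s)
          base = *-cancelˡ-≤ N (begin
            N * (a ^ ρ * (b * wT))        ≡⟨ shuffle₁ N (a ^ ρ) b wT ⟩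
            N * b * (a ^ ρ * wT)          ≡⟨ cong (N * b *_) ∑-selected-w ⟨
            N * b * ∑ (upTo n) (λ t → [[ mem T t ]] * (a ^ ρ * w t)) ≤⟨ fingerprint-bound ⟩
            K * (ρ * (c * a ^ r * mV) + N * b * (b ^ ρ * s)) ≡⟨ cong (λ z → K * (ρ * (c * a ^ r * z) + N * b * (b ^ ρ * s))) mV≡ ⟩
            K * (ρ * (c * a ^ r * (b ^ n * n * (1 + E) * D)) + N * b * (b ^ ρ * s))
              ≡⟨ shuffle₂ n E ρ c (a ^ r) (b ^ n) D b (b ^ ρ) s ⟩
            N * (n * (ρ * c * a ^ r * (1 + E) * D + E * b ^ r * s)) ∎)
            where
            shuffle₁ : ∀ N u b x → N * (u * (b * x)) ≡ N * b * (u * x)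
            shuffle₁ = solve-∀
            shuffle₂ : ∀ n E ρ z x c D b v s → n * E * (ρ * (z * x * (c * n * (1 + E) * D)) + E * n * c * b * (v * s))
                       ≡ E * n * c * (n * (ρ * z * x * (1 + E) * D + E * (b * v) * s))
            shuffle₂ = solve-∀
          1+E≤2E : 1 + E ≤ 2 * E
          1+E≤2E = +-mono-≤ E>0 (≤-reflexive (sym (+-identityʳ E)))
          X Q : ℕ
          X = a ^ ρ * (b * wT)
          Q = n * (2 * E) * c * a ^ r * D
          base′ : X ≤ ρ * Q + n * E * (b ^ r * s)
          base′ = begin
            X                                                        ≤⟨ base ⟩
            n * (ρ * c * a ^ r * (1 + E) * D + E * b ^ r * s)
              ≤⟨ *-monoʳ-≤ n (+-monoˡ-≤ _ (*-monoˡ-≤ D (*-monoʳ-≤ (ρ * c * a ^ r) 1+E≤2E))) ⟩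
            n * (ρ * c * a ^ r * (2 * E) * D + E * b ^ r * s)
              ≡⟨ shuffle n ρ c (a ^ r) E D (b ^ r) s ⟩
            ρ * Q + n * E * (b ^ r * s)                              ∎
            where
            shuffle : ∀ n ρ c u E D v s → n * (ρ * c * u * (2 * E) * D + E * v * s) ≡ ρ * (n * (2 * E) * c * u * D) + n * E * (v * s)
            shuffle = solve-∀
          2ρQ+2Q : 2 * (ρ * Q + Q) ≡ a ^ ρ * (n * E * (2 * κ) * a * D)
          2ρQ+2Q = trans (shuffle ρ n E c a (a ^ ρ) D) (cong (λ z → a ^ ρ * (n * E * (2 * z) * a * D)) (sym κ-def))
            where
            shuffle : ∀ ρ n E c a u D → 2 * (ρ * (n * (2 * E) * c * (a * u) * D) + n * (2 * E) * c * (a * u) * D)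
                      ≡ u * (n * E * (2 * ((1 + ρ) * (2 * c))) * a * D)
            shuffle = solve-∀
          weigh : b ^ r * s ≤ a ^ r * D ⊎ 2 * E * n * b ^ ρ * s ≤ a ^ ρ * D * ∣ T ∣ →
                  X ≤ a ^ ρ * (n * E * (2 * κ) * a * D)
          weigh (inj₁ few) = begin
            X                                ≤⟨ base′ ⟩
            ρ * Q + n * E * (b ^ r * s)      ≤⟨ +-monoʳ-≤ (ρ * Q) (*-monoʳ-≤ (n * E) few) ⟩
            ρ * Q + n * E * (a ^ r * D)      ≤⟨ +-monoʳ-≤ (ρ * Q) (m≤n*m _ (2 * c) {{m*n≢0 2 c {{_}} {{m^n≢0 2 r}}}}) ⟩
            ρ * Q + 2 * c * (n * E * (a ^ r * D)) ≡⟨ cong (ρ * Q +_) (shuffle c n E (a ^ r) D) ⟩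
            ρ * Q + Q                        ≤⟨ m≤n*m (ρ * Q + Q) 2 ⟩
            2 * (ρ * Q + Q)                  ≡⟨ 2ρQ+2Q ⟩
            a ^ ρ * (n * E * (2 * κ) * a * D) ∎
            where
            shuffle : ∀ c n E u D → 2 * c * (n * E * (u * D)) ≡ n * (2 * E) * c * u * D
            shuffle = solve-∀
          weigh (inj₂ few) = begin
            X                                ≤⟨ +-cancelʳ-≤ X X (2 * (ρ * Q)) doubled ⟩
            2 * (ρ * Q)                      ≤⟨ *-monoʳ-≤ 2 (m≤m+n (ρ * Q) Q) ⟩
            2 * (ρ * Q + Q)                  ≡⟨ 2ρQ+2Q ⟩
            a ^ ρ * (n * E * (2 * κ) * a * D) ∎
            where
            shuffle₁ : ∀ x n E b v s → 2 * (x + n * E * (b * v * s)) ≡ 2 * x + b * (2 * E * n * v * s)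
            shuffle₁ = solve-∀
            shuffle₂ : ∀ b u D t → b * (u * D * t) ≡ u * (b * (D * t))
            shuffle₂ = solve-∀
            -- The last level costs at most the part `D * ∣ T ∣` of `wT`, that is, at most one copy
            -- of `X`, which cancels.
            doubled : X + X ≤ 2 * (ρ * Q) + X
            doubled = begin
              X + X                                            ≡⟨ cong (X +_) (+-identityʳ X) ⟨
              2 * X                                            ≤⟨ *-monoʳ-≤ 2 base′ ⟩
              2 * (ρ * Q + n * E * (b ^ r * s))                ≡⟨ shuffle₁ (ρ * Q) n E b (b ^ ρ) s ⟩
              2 * (ρ * Q) + b * (2 * E * n * b ^ ρ * s)        ≤⟨ +-monoʳ-≤ (2 * (ρ * Q)) (*-monoʳ-≤ b few) ⟩
              2 * (ρ * Q) + b * (a ^ ρ * D * ∣ T ∣)            ≡⟨ cong (2 * (ρ * Q) +_) (shuffle₂ b (a ^ ρ) D ∣ T ∣) ⟩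
              2 * (ρ * Q) + a ^ ρ * (b * (D * ∣ T ∣))          ≤⟨ +-monoʳ-≤ (2 * (ρ * Q)) (*-monoʳ-≤ (a ^ ρ) (*-monoʳ-≤ b (m≤n+m _ _))) ⟩
              2 * (ρ * Q) + X                                  ∎

        module _ (h : b ^ r * size (final r) ≤ a ^ r * D ⊎ 2 * E * n * b ^ ρ * size (final r) ≤ a ^ ρ * D * ∣ T ∣) where

          -- `Δ` is chosen to cancel `2 * E * κ` and to leave the surplus `2 * E`, which makes `T`
          -- negligible in `E-weight`.
          scaled-weight : 2 * E * (q * wT) ≤ n * (p * D)
          scaled-weight = *-cancelˡ-≤ (2 * E * κ) {{m*n≢0 (2 * E) κ {{m*n≢0 2 E}} {{>-nonZero κ>0}}}} (begin
            2 * E * κ * (2 * E * (q * wT))    ≡⟨ shuffle₁ E κ q wT ⟩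
            4 * (E * E * κ) * q * wT          ≡⟨ cong (λ z → z * q * wT) Δ-def ⟨
            b * wT                            ≤⟨ fingerprint-weight h ⟩
            n * E * (2 * κ) * p * D           ≡⟨ shuffle₂ n E κ p D ⟩
            2 * E * κ * (n * (p * D))         ∎)
            where
            open ≤-Reasoning
            shuffle₁ : ∀ E κ q x → 2 * E * κ * (2 * E * (q * x)) ≡ 4 * (E * E * κ) * q * x
            shuffle₁ = solve-∀
            shuffle₂ : ∀ n E κ p D → n * E * (2 * κ) * p * D ≡ 2 * E * κ * (n * (p * D))
            shuffle₂ = solve-∀

          2E-weight : 2 * E * (q * weight d T) ≤ p * D
          2E-weight = *-cancelˡ-≤ n (begin
            n * (2 * E * (q * weight d T))    ≡⟨ shuffle n (2 * E) q (weight d T) ⟩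
            2 * E * (q * (n * weight d T))    ≤⟨ *-monoʳ-≤ (2 * E) (*-monoʳ-≤ q (m≤m+n _ _)) ⟩
            2 * E * (q * wT)                  ≤⟨ scaled-weight ⟩
            n * (p * D)                       ∎)
            where
            open ≤-Reasoning
            shuffle : ∀ n x q d → n * (x * (q * d)) ≡ x * (q * (n * d))
            shuffle = solve-∀

          weight-bound : q * weight d T ≤ p * D
          weight-bound = ≤-trans (m≤n*m (q * weight d T) (2 * E) {{m*n≢0 2 E}}) 2E-weight

          card-bound : q * ∣ T ∣ ≤ p * n
          card-bound = *-cancelˡ-≤ D (begin
            D * (q * ∣ T ∣)                   ≡⟨ shuffle₁ D q ∣ T ∣ ⟩
            q * (D * ∣ T ∣)                   ≤⟨ *-monoʳ-≤ q (m≤n+m _ _) ⟩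
            q * wT                            ≤⟨ m≤n*m (q * wT) (2 * E) {{m*n≢0 2 E}} ⟩
            2 * E * (q * wT)                  ≤⟨ scaled-weight ⟩
            n * (p * D)                       ≡⟨ shuffle₂ n p D ⟩
            D * (p * n)                       ∎)
            where
            open ≤-Reasoning
            shuffle₁ : ∀ D q t → D * (q * t) ≡ q * (D * t)
            shuffle₁ = solve-∀
            shuffle₂ : ∀ n p D → n * (p * D) ≡ D * (p * n)
            shuffle₂ = solve-∀

          module _ (p≤q : p ≤ q) where

            E-weight : E * weight d T ≤ D
            E-weight = *-cancelˡ-≤ q (begin
              q * (E * weight d T)            ≡⟨ shuffle q E (weight d T) ⟩
              E * (q * weight d T)            ≤⟨ *-monoˡ-≤ (q * weight d T) (m≤n*m E 2) ⟩
              2 * E * (q * weight d T)        ≤⟨ 2E-weight ⟩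
              p * D                           ≤⟨ *-monoˡ-≤ D p≤q ⟩
              q * D                           ∎)
              where
              open ≤-Reasoning
              shuffle : ∀ q E d → q * (E * d) ≡ E * (q * d)
              shuffle = solve-∀

            -- Every vertex is in exactly one of the two sets, except for those of `T`, which are in
            -- both.
            dB+dC≤ : dB + dC ≤ D + weight d T
            dB+dC≤ = begin
              dB + dC                ≡⟨ ∑-+ (upTo n) _ _ ⟨
              ∑ (upTo n) (λ t → [[ outside t ]] * d t + [[ mem (container T) t ]] * d t) ≤⟨ ∑-mono-All (all-upTo n point) ⟩
              ∑ (upTo n) (λ t → d t + [[ mem T t ]] * d t) ≡⟨ ∑-+ (upTo n) _ _ ⟩
              D + weight d T         ∎
              where
              open ≤-Reasoning
              disjoint : ∀ x y k → [[ x ∨ y ]] * k + [[ x ∨ not y ]] * k ≤ k + [[ x ]] * k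
              disjoint true  y     k = ≤-reflexive (cong (_+ 1 * k) (*-identityˡ k))
              disjoint false true  k = ≤-reflexive (cong (_+ 0) (*-identityˡ k))
              disjoint false false k = ≤-reflexive (trans (*-identityˡ k) (sym (+-identityʳ k)))
              point : ∀ t → t < n → [[ outside t ]] * d t + [[ mem (container T) t ]] * d t ≤ d t + [[ mem T t ]] * d t
              point t t<n rewrite mem-fromPred {n} (λ t → mem T t ∨ not (large t (run (mem T) t))) t<n =
                disjoint (mem T t) (large t (run (mem T) t)) (d t)

            -- `core` yields the stronger bound with `E` in place of `Z`: `container-degree` gains
            -- `3 * D` and counting `T` twice loses at most `D`. Then `Z` is a multiple of `E`.
            container-weight : Z * dC + D ≤ Z * D
            container-weight = begin
              Z * dC + D                     ≤⟨ +-monoʳ-≤ (Z * dC) (m≤n*m D z {{m*n≢0 2 (Δ ^ r) {{_}} {{m^n≢0 Δ r}}}}) ⟩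
              Z * dC + z * D                 ≡⟨ cong (λ y → y * dC + z * D) Z-def ⟩
              E * z * dC + z * D             ≡⟨ shuffle₁ E z dC D ⟩
              z * (E * dC + D)               ≤⟨ *-monoʳ-≤ z (+-cancelˡ-≤ (2 * D) _ _ core) ⟩
              z * (E * D)                    ≡⟨ shuffle₂ E z D ⟩
              E * z * D                      ≡⟨ cong (_* D) Z-def ⟨
              Z * D                          ∎
              where
              open ≤-Reasoning
              z : ℕ
              z = 2 * Δ ^ r
              shuffle₁ : ∀ E z x D → E * z * x + z * D ≡ z * (E * x + D)
              shuffle₁ = solve-∀
              shuffle₂ : ∀ E z D → z * (E * D) ≡ E * z * D
              shuffle₂ = solve-∀
              shuffle₃ : ∀ D x → 2 * D + (x + D) ≡ 3 * D + x
              shuffle₃ = solve-∀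
              shuffle₄ : ∀ D x → x + D ≤ 2 * D + x
              shuffle₄ D x = ≤-trans (≤-reflexive (+-comm x D)) (+-monoˡ-≤ x (m≤m+n D _))
              core : 2 * D + (E * dC + D) ≤ 2 * D + E * D
              core = begin
                2 * D + (E * dC + D)         ≡⟨ shuffle₃ D (E * dC) ⟩
                3 * D + E * dC               ≤⟨ +-monoˡ-≤ (E * dC) container-degree ⟩
                E * dB + E * dC              ≡⟨ *-distribˡ-+ E dB dC ⟨
                E * (dB + dC)                ≤⟨ *-monoʳ-≤ E dB+dC≤ ⟩
                E * (D + weight d T)         ≡⟨ *-distribˡ-+ E D (weight d T) ⟩
                E * D + E * weight d T       ≤⟨ +-monoʳ-≤ (E * D) E-weight ⟩
                E * D + D                    ≤⟨ shuffle₄ D (E * D) ⟩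
                2 * D + E * D                ∎

open Combinatorics

open import Algebra.Bundles using (CommutativeMonoid)
open import Data.Fin using (Fin; zero; suc)
open import Data.Nat as ℕ using (ℕ; zero; suc; NonZero; z≤n; s≤s; s<s; z<s; >-nonZero)
import Data.Nat.Coprimality as C
import Data.Nat.Properties as ℕ
open import Data.Integer as ℤ using (ℤ; +_; -[1+_])
open import Data.Integer.DivMod using ([n/d]*d≤n)
import Data.Integer.Properties as ℤ
open import Data.Rational using (ℚ; mkℚ; 0ℚ; 1ℚ; _≤_; _<_; _*_; _+_; _-_; -_; _/_; *≤*; *<*; floor; toℚᵘ; Positive)
import Data.Rational.Properties as ℚ
open import Data.Rational.Unnormalised as ℚᵘ using (mkℚᵘ; *≡*)
import Data.Rational.Unnormalised.Properties as ℚᵘ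
open import Data.Fin.Subset using (Subset; _⊆_; _∩_; ∣_∣; ⊤) renaming (_-_ to _∖_)
open import Algebra.Properties.CommutativeSemigroup (CommutativeMonoid.commutativeSemigroup ℚ.*-1-commutativeMonoid) using (interchange)

-- Rational numbers as fractions

-- `_/ 1` divides by a gcd and does not compute for variable `k`; this normal form does.
ℕtoℚ≡ : ∀ k → ℕtoℚ k ≡ mkℚ (+ k) 0 (C.sym (C.1-coprimeTo k))
ℕtoℚ≡ k = ℚ.fromℚᵘ-toℚᵘ (mkℚ (+ k) 0 (C.sym (C.1-coprimeTo k)))

ℕtoℚ-* : ∀ k l → ℕtoℚ (k ℕ.* l) ≡ ℕtoℚ k * ℕtoℚ l
ℕtoℚ-* k l = trans (cong (_/ 1) (ℤ.pos-* k l)) (sym (cong₂ _*_ (ℕtoℚ≡ k) (ℕtoℚ≡ l)))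

ℕtoℚ-+ : ∀ k l → ℕtoℚ (k ℕ.+ l) ≡ ℕtoℚ k + ℕtoℚ l
ℕtoℚ-+ k l = trans (cong (_/ 1) (cong₂ ℤ._+_ (sym (ℤ.*-identityʳ (+ k))) (sym (ℤ.*-identityʳ (+ l))))) (sym (cong₂ _+_ (ℕtoℚ≡ k) (ℕtoℚ≡ l)))

ℕtoℚ-mono-≤ : ∀ {k l} → k ℕ.≤ l → ℕtoℚ k ≤ ℕtoℚ l
ℕtoℚ-mono-≤ {k} {l} k≤l = subst₂ _≤_ (sym (ℕtoℚ≡ k)) (sym (ℕtoℚ≡ l))
  (*≤* (subst₂ ℤ._≤_ (sym (ℤ.*-identityʳ (+ k))) (sym (ℤ.*-identityʳ (+ l))) (ℤ.+≤+ k≤l)))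

ℕtoℚ-cancel-≤ : ∀ {k l} → ℕtoℚ k ≤ ℕtoℚ l → k ℕ.≤ l
ℕtoℚ-cancel-≤ {k} {l} h with subst₂ _≤_ (ℕtoℚ≡ k) (ℕtoℚ≡ l) h
... | *≤* le = ℤ.drop‿+≤+ (subst₂ ℤ._≤_ (ℤ.*-identityʳ (+ k)) (ℤ.*-identityʳ (+ l)) le)

ℕtoℚ-pos : ∀ k .{{_ : NonZero k}} → Positive (ℕtoℚ k)
ℕtoℚ-pos (suc k) = subst Positive (sym (ℕtoℚ≡ (suc k))) _

infix 4 _≐_∕_

-- For u = 0 this says nothing about x.
record _≐_∕_ (x : ℚ) (k u : ℕ) : Set where
  constructor cross
  field
    uncross : x * ℕtoℚ u ≡ ℕtoℚ k

≐-ℕ : ∀ k → ℕtoℚ k ≐ k ∕ 1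
≐-ℕ k = cross (ℚ.*-identityʳ (ℕtoℚ k))

≐-* : ∀ {x y k l u v} → x ≐ k ∕ u → y ≐ l ∕ v → x * y ≐ k ℕ.* l ∕ u ℕ.* v
≐-* {x} {y} {k} {l} {u} {v} (cross p) (cross q) = cross (trans (cong (x * y *_) (ℕtoℚ-* u v))
  (trans (interchange x y (ℕtoℚ u) (ℕtoℚ v)) (trans (cong₂ _*_ p q) (sym (ℕtoℚ-* k l)))))

≐-^ : ∀ {x k u} j → x ≐ k ∕ u → x ^ℚ j ≐ k ℕ.^ j ∕ u ℕ.^ j
≐-^ zero    p = cross refl
≐-^ (suc j) p = ≐-* p (≐-^ j p)

-- Checked among unnormalised fractions, where no gcd is in the way and equality is cross
-- multiplication.
≐-/ : ∀ i u → (i / suc u) * ℕtoℚ (suc u) ≡ i / 1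
≐-/ i u = ℚ.toℚᵘ-injective (begin
  toℚᵘ ((i / suc u) * ℕtoℚ (suc u))               ≈⟨ ℚ.toℚᵘ-homo-* (i / suc u) (ℕtoℚ (suc u)) ⟩
  toℚᵘ (i / suc u) ℚᵘ.* toℚᵘ (ℕtoℚ (suc u))       ≈⟨ ℚᵘ.*-cong (ℚ.toℚᵘ-fromℚᵘ (mkℚᵘ i u)) (ℚ.toℚᵘ-fromℚᵘ (mkℚᵘ (+ suc u) 0)) ⟩
  mkℚᵘ i u ℚᵘ.* mkℚᵘ (+ suc u) 0                  ≈⟨ *≡* (trans (ℤ.*-identityʳ _) (cong (i ℤ.*_) (cong +_ (sym (ℕ.*-identityʳ (suc u)))))) ⟩
  mkℚᵘ i 0                                        ≈⟨ ℚ.toℚᵘ-fromℚᵘ (mkℚᵘ i 0) ⟨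
  toℚᵘ (i / 1)                                    ∎)
  where open ℚᵘ.≃-Reasoning

≐-÷ : ∀ k u .{{_ : NonZero u}} → k ÷ℕ u ≐ k ∕ u
≐-÷ k (suc u) = cross (≐-/ (+ k) u)

≐-cross : ∀ x {k u} → x ≐ k ∕ u → ∀ v → ℕtoℚ (k ℕ.* v) ≡ x * ℕtoℚ (u ℕ.* v)
≐-cross x {k} {u} (cross p) v = trans (ℕtoℚ-* k v) (trans (cong (_* ℕtoℚ v) (sym p))
  (trans (ℚ.*-assoc x (ℕtoℚ u) (ℕtoℚ v)) (cong (x *_) (sym (ℕtoℚ-* u v)))))

module _ {x y k l u v} .{{_ : NonZero u}} .{{_ : NonZero v}} (p : x ≐ k ∕ u) (q : y ≐ l ∕ v) where

  private
    x-cross : ℕtoℚ (k ℕ.* v) ≡ x * ℕtoℚ (u ℕ.* v)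
    x-cross = ≐-cross x {k} {u} p v

    y-cross : ℕtoℚ (l ℕ.* u) ≡ y * ℕtoℚ (u ℕ.* v)
    y-cross = trans (≐-cross y {l} {v} q u) (cong (λ z → y * ℕtoℚ z) (ℕ.*-comm v u))

    instance
      positive-uv : Positive (ℕtoℚ (u ℕ.* v))
      positive-uv = ℕtoℚ-pos (u ℕ.* v) {{ℕ.m*n≢0 u v}}

  ≐⇒≤ : k ℕ.* v ℕ.≤ l ℕ.* u → x ≤ y
  ≐⇒≤ h = ℚ.*-cancelʳ-≤-pos (ℕtoℚ (u ℕ.* v)) (subst₂ _≤_ x-cross y-cross (ℕtoℚ-mono-≤ h))

  ≤⇒≐ : x ≤ y → k ℕ.* v ℕ.≤ l ℕ.* u
  ≤⇒≐ h = ℕtoℚ-cancel-≤ (subst₂ _≤_ (sym x-cross) (sym y-cross)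
    (ℚ.*-monoʳ-≤-nonNeg (ℕtoℚ (u ℕ.* v)) {{ℚ.pos⇒nonNeg (ℕtoℚ (u ℕ.* v))}} h))

≐-1- : ∀ {x u} .{{_ : NonZero u}} → x ≐ 1 ∕ u → 1ℚ - x ≐ u ℕ.∸ 1 ∕ u
≐-1- {x} {suc u} (cross p) = cross (begin
  (1ℚ - x) * U                       ≡⟨ ℚ.*-distribʳ-+ U 1ℚ (- x) ⟩
  1ℚ * U + - x * U                   ≡⟨ cong₂ _+_ (ℚ.*-identityˡ U) (sym (ℚ.neg-distribˡ-* x U)) ⟩
  U + - (x * U)                      ≡⟨ cong₂ (λ y z → y + - z) (ℕtoℚ-+ 1 u) p ⟩
  1ℚ + ℕtoℚ u + - 1ℚ                 ≡⟨ cong (_+ - 1ℚ) (ℚ.+-comm 1ℚ (ℕtoℚ u)) ⟩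
  ℕtoℚ u + 1ℚ + - 1ℚ                 ≡⟨ ℚ.+-assoc (ℕtoℚ u) 1ℚ (- 1ℚ) ⟩
  ℕtoℚ u + 0ℚ                        ≡⟨ ℚ.+-identityʳ (ℕtoℚ u) ⟩
  ℕtoℚ u                             ∎)
  where
  open ≡-Reasoning
  U = ℕtoℚ (suc u)

÷-positive : ∀ k u → 0ℚ < k ÷ℕ u → NonZero k × NonZero u
÷-positive k       zero    h = contradiction h (ℚ.<-irrefl refl)
÷-positive (suc k) (suc u) h = _ , _
÷-positive zero    (suc u) h = contradiction (ℚ.<-≤-trans h (≐⇒≤ (≐-÷ 0 (suc u)) (≐-ℕ 0) z≤n)) (ℚ.<-irrefl refl)

0<1÷ : ∀ u .{{_ : NonZero u}} → 0ℚ < 1 ÷ℕ u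
0<1÷ (suc u) = ℚ.positive⁻¹ (1 ÷ℕ suc u) {{ℚ.normalize-pos 1 (suc u)}}

floor-≤ : ∀ x k → floor x ≡ + k → ℕtoℚ k ≤ x
floor-≤ x@(mkℚ i d _) k eq = subst (_≤ x) (sym (ℕtoℚ≡ k))
  (*≤* (subst₂ ℤ._≤_ (cong (ℤ._* + suc d) eq) (sym (ℤ.*-identityʳ i)) ([n/d]*d≤n i (+ suc d))))

-- Gives a natural number as degeneracy bound with no sign condition on `x`: below a negative floor
-- there is no natural number, and 0 serves.
⌊⌋-truncated : ∀ x → ∃ λ k → (∀ y → + y ℤ.≤ floor x → y ℕ.≤ k) × (k ≡ 0 ⊎ ℕtoℚ k ≤ x)
⌊⌋-truncated x with floor x in eq
... | + k      = k , (λ y → ℤ.drop‿+≤+) , inj₂ (floor-≤ x k eq)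
... | -[1+ _ ] = 0 , (λ y ()) , inj₁ refl

positive-fraction : ∀ τ → 0ℚ < τ → ∃₂ λ p q → NonZero p × NonZero q × τ ≐ p ∕ q
positive-fraction τ@(mkℚ (+ p) q-1 _) 0<τ = p , suc q-1 , p≢0 p 0<τ , _ , eq
  where
  eq : τ ≐ p ∕ suc q-1
  eq = cross (trans (cong (_* ℕtoℚ (suc q-1)) (sym (ℚ.↥p/↧p≡p τ))) (≐-/ (+ p) q-1))
  p≢0 : ∀ p .{c : C.Coprime p (suc q-1)} → 0ℚ < mkℚ (+ p) q-1 c → NonZero p
  p≢0 zero    (*<* (ℤ.+<+ ()))
  p≢0 (suc _) _ = _
positive-fraction (mkℚ -[1+ _ ] _ _) (*<* ())

-- Degrees and induced edges

does-∈? : ∀ {n} (v : Fin n) (p : Subset n) → does (v ∈? p) ≡ mem p (toℕ v)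
does-∈? zero    (true  ∷ p) = refl
does-∈? zero    (false ∷ p) = refl
does-∈? (suc v) (x ∷ p)     = does-∈? v p

does-⊆? : ∀ {n} (σ f : Subset n) → does (σ ⊆? f) ≡ sub σ f
does-⊆? []          []          = refl
does-⊆? (false ∷ σ) (y     ∷ f) = does-⊆? σ f
does-⊆? (true  ∷ σ) (false ∷ f) = refl
does-⊆? (true  ∷ σ) (true  ∷ f) = does-⊆? σ f

does⇒ : ∀ {P : Set} (P? : Dec P) → does P? ≡ true → P
does⇒ (yes p) _ = p

sub⇒⊆ : ∀ {n} {σ f : Subset n} → sub σ f ≡ true → σ ⊆ f
sub⇒⊆ {σ = σ} {f} h = does⇒ (σ ⊆? f) (trans (does-⊆? σ f) h)

⊆⇒sub : ∀ {n} {σ f : Subset n} → σ ⊆ f → sub σ f ≡ true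
⊆⇒sub {σ = σ} {f} h = trans (sym (does-⊆? σ f)) (dec-true (σ ⊆? f) h)

mem⇒⊆ : ∀ {n} {p q : Subset n} → (∀ t → t ℕ.< n → mem p t ≡ true → mem q t ≡ true) → p ⊆ q
mem⇒⊆ {p = p} {q} h {v} v∈p = does⇒ (v ∈? q) (trans (does-∈? v q)
  (h (toℕ v) (toℕ<n v) (trans (sym (does-∈? v p)) (dec-true (v ∈? p) v∈p))))

mem-ext : ∀ {n} {p q : Subset n} → (∀ t → t ℕ.< n → mem p t ≡ mem q t) → p ≡ q
mem-ext {p = []}    {[]}    h = refl
mem-ext {p = x ∷ p} {y ∷ q} h = cong₂ _∷_ (h 0 z<s) (mem-ext (λ t t<n → h (suc t) (s<s t<n)))

mem-∩ : ∀ {n} (p q : Subset n) t → mem (p ∩ q) t ≡ mem p t ∧ mem q t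
mem-∩ []      []      t       = refl
mem-∩ (x ∷ p) (y ∷ q) zero    = refl
mem-∩ (x ∷ p) (y ∷ q) (suc t) = mem-∩ p q t

mem-⊤ : ∀ {n} t → t ℕ.< n → mem (⊤ {n}) t ≡ true
mem-⊤ {suc n} zero    _       = refl
mem-⊤ {suc n} (suc t) (s≤s h) = mem-⊤ t h

∑-tabulate : ∀ {A : Set} n (f : Fin n → A) (g : A → ℕ) (h : ℕ → ℕ) → (∀ i → g (f i) ≡ h (toℕ i)) → ∑ (List.tabulate f) g ≡ ∑ (upTo n) h
∑-tabulate zero    f g h eq = refl
∑-tabulate (suc n) f g h eq = trans (cong₂ ℕ._+_ (eq zero) (∑-tabulate n (f ∘ suc) g (h ∘ suc) (eq ∘ suc))) (sym (∑-upTo-suc n h))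

module _ {n : ℕ} (G : Hypergraph n) where

  deg≡ : ∀ v → deg G v ≡ degreeAt G (toℕ v)
  deg≡ v = trans (length-filter (v ∈?_) G) (∑-cong G (λ f → cong [[_]] (does-∈? v f)))

  codeg≡ : ∀ σ → codeg G σ ≡ codegree G σ
  codeg≡ σ = trans (length-filter (σ ⊆?_) G) (∑-cong G (λ f → cong [[_]] (does-⊆? σ f)))

  eInd≡ : ∀ I → eInd G I ≡ ∑ G (λ f → [[ sub f I ]])
  eInd≡ I = trans (length-filter (_⊆? I) G) (∑-cong G (λ f → cong [[_]] (does-⊆? f I)))

  degSum≡ : ∀ S → degSum G S ≡ weight (degreeAt G) S
  degSum≡ S = trans (sum-map (deg G) (filter (_∈? S) (allFin n))) (trans (∑-filter (_∈? S) (allFin n) (deg G))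
    (∑-tabulate n id _ _ (λ v → cong₂ (λ x y → [[ x ]] ℕ.* y) (does-∈? v S) (deg≡ v))))

  degSum-⊤ : degSum G ⊤ ≡ totalDegree G
  degSum-⊤ = trans (degSum≡ ⊤) (∑-cong-All (all-upTo n (λ t t<n →
    trans (cong (λ x → [[ x ]] ℕ.* degreeAt G t) (mem-⊤ t t<n)) (ℕ.*-identityˡ _))))

  induced-mono : ∀ {S S′} → S ⊆ S′ → ∑ G (λ f → [[ sub f S ]]) ℕ.≤ ∑ G (λ f → [[ sub f S′ ]])
  induced-mono S⊆S′ = ∑-mono G (λ f → [[]]-mono (λ h → ⊆⇒sub (S⊆S′ ∘ sub⇒⊆ {σ = f} h)))

  module _ {ρ : ℕ} (uniform : All (λ f → ∣ f ∣ ≡ suc ρ) G) where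

    -- Delete vertices of degree at most k one at a time.
    induced-degenerate : ∀ {z k I} → Degenerate G z I → (∀ x → + x ℤ.≤ z → x ℕ.≤ k) →
                         ∀ c W → ∣ W ∣ ℕ.≤ c → W ⊆ I → ∑ G (λ f → [[ sub f W ]]) ℕ.≤ k ℕ.* ∣ W ∣
    induced-degenerate {z} {k} {I} degenerate z≤k c W ∣W∣≤c W⊆I with nonempty? W
    ... | no  empty = ℕ.≤-trans (ℕ.≤-reflexive (trans (∑-cong-All (All.map (λ {f} → none f) uniform)) (∑-0 G))) z≤n
      where
      none : ∀ f → ∣ f ∣ ≡ suc ρ → [[ sub f W ]] ≡ 0
      none f eq with sub f W in s
      ... | false = refl
      ... | true  = contradiction (subst₂ ℕ._≤_ eq (trans (cong ∣_∣ (Empty-unique empty)) (∣⊥∣≡0 n)) (sub⇒∣∣≤ f W s)) λ ()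
    induced-degenerate {z} {k} {I} degenerate z≤k zero W ∣W∣≤c W⊆I | yes (v , v∈W) =
      contradiction (ℕ.<-≤-trans (x∈p⇒∣p-x∣<∣p∣ v∈W) ∣W∣≤c) λ ()
    induced-degenerate {z} {k} {I} degenerate z≤k (suc c) W ∣W∣≤c W⊆I | yes nonempty
      with degenerate W W⊆I nonempty (λ _ → true)
    ... | v , v∈W , few = begin
      ∑ G (λ f → [[ sub f W ]])                                    ≤⟨ ∑-mono G split ⟩
      ∑ G (λ f → [[ sub f (W ∖ v) ]] ℕ.+ [[ sub f W ]] ℕ.* [[ mem f (toℕ v) ]])
        ≡⟨ ∑-+ G _ _ ⟩
      ∑ G (λ f → [[ sub f (W ∖ v) ]]) ℕ.+ ∑ G (λ f → [[ sub f W ]] ℕ.* [[ mem f (toℕ v) ]])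
        ≤⟨ ℕ.+-mono-≤ (induced-degenerate degenerate z≤k c (W ∖ v) (ℕ.≤-pred (ℕ.<-≤-trans smaller ∣W∣≤c)) (W⊆I ∘ p─q⊆p W _)) (subst (ℕ._≤ k) degree (z≤k _ few)) ⟩
      k ℕ.* ∣ W ∖ v ∣ ℕ.+ k                                        ≡⟨ trans (ℕ.+-comm _ k) (sym (ℕ.*-suc k ∣ W ∖ v ∣)) ⟩
      k ℕ.* suc ∣ W ∖ v ∣                                          ≤⟨ ℕ.*-monoʳ-≤ k smaller ⟩
      k ℕ.* ∣ W ∣                                                  ∎
      where
      open ℕ.≤-Reasoning
      smaller : ∣ W ∖ v ∣ ℕ.< ∣ W ∣
      smaller = x∈p⇒∣p-x∣<∣p∣ v∈W
      degree : length (filter (v ∈?_) (filter (λ f → T? (does (f ⊆? W))) G)) ≡ ∑ G (λ f → [[ sub f W ]] ℕ.* [[ mem f (toℕ v) ]])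
      degree = trans (length-filter (v ∈?_) (filter (λ f → T? (does (f ⊆? W))) G)) (trans (∑-filter _ G _)
        (∑-cong G (λ f → cong₂ (λ x y → [[ x ]] ℕ.* [[ y ]]) (does-⊆? f W) (does-∈? v f))))
      split : ∀ f → [[ sub f W ]] ℕ.≤ [[ sub f (W ∖ v) ]] ℕ.+ [[ sub f W ]] ℕ.* [[ mem f (toℕ v) ]]
      split f with sub f W in s | mem f (toℕ v) in v∈f
      ... | false | _     = z≤n
      ... | true  | true  = ℕ.m≤n+m 1 _
      ... | true  | false = ℕ.≤-trans (ℕ.≤-reflexive (cong [[_]] (sym (⊆⇒sub avoid)))) (ℕ.m≤m+n _ 0)
        where
        avoid : f ⊆ W ∖ v
        avoid {x} x∈f = x∈p∧x≢y⇒x∈p-y (sub⇒⊆ {σ = f} s x∈f) λ { refl →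
          contradiction (trans (sym v∈f) (trans (sym (does-∈? v f)) (dec-true (v ∈? f) x∈f))) λ () }

    independent⇒induced≡0 : ∀ {I} → Independent G I → eInd G I ≡ 0
    independent⇒induced≡0 {I} independent = trans (eInd≡ I) (trans (∑-cong-All (All.tabulate (λ {f} → none f))) (∑-0 G))
      where
      none : ∀ f → f ∈ₗ G → [[ sub f I ]] ≡ 0
      none f f∈G with sub f I in s
      ... | false = refl
      ... | true  = ⊥-elim (independent f f∈G (λ {x} → sub⇒⊆ {σ = f} s {x}))

mem-prefix : ∀ {n} w t → t ℕ.< n → mem (prefix n w) t ≡ (t ℕ.<ᵇ w)
mem-prefix {n} w t t<n = mem-fromPred {n} (λ t → t ℕ.<ᵇ w) t<n

∧-congʳ-when : ∀ {x y} z → (z ≡ true → x ≡ y) → x ∧ z ≡ y ∧ z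
∧-congʳ-when false h = trans (∧-zeroʳ _) (sym (∧-zeroʳ _))
∧-congʳ-when true  h = cong (_∧ true) (h refl)

-- From the rational hypotheses to natural numbers and back

module Graph {ρ : ℕ} (cst : Constants ρ) {n : ℕ} (G : Hypergraph n) (uniform : All (λ f → ∣ f ∣ ≡ suc ρ) G)
  {τ : ℚ} {p q : ℕ} (τ≐ : τ ≐ p ∕ q) (τ≤1 : τ ≤ 1ℚ)
  .{{_ : NonZero p}} .{{_ : NonZero q}} .{{_ : NonZero n}} .{{_ : NonZero (totalDegree G)}} .{{_ : NonZero (size G)}}
  (sparse : (σ : Subset n) → 2 ℕ.≤ ∣ σ ∣ →
    ℕtoℚ (codeg G σ) ≤ (1 ÷ℕ Constants.Z cst) * avgDeg G * (τ ^ℚ (∣ σ ∣ ℕ.∸ 1))) where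

  open Constants cst

  c : ℚ
  c = 1 ÷ℕ Z

  instance
    Z≢0 : NonZero Z
    Z≢0 = >-nonZero Z>0

  q^k≢0 : ∀ k → NonZero (q ℕ.^ k)
  q^k≢0 k = ℕ.m^n≢0 q k

  c≐ : c ≐ 1 ∕ Z
  c≐ = ≐-÷ 1 Z

  avg≐ : avgDeg G ≐ totalDegree G ∕ n
  avg≐ = subst (λ D → D ÷ℕ n ≐ totalDegree G ∕ n) (sym (degSum-⊤ G)) (≐-÷ (totalDegree G) n)

  μ≐ : ∀ S → μ G S ≐ weight (degreeAt G) S ∕ totalDegree G
  μ≐ S = subst₂ (λ k D → k ÷ℕ D ≐ weight (degreeAt G) S ∕ totalDegree G) (sym (degSum≡ G S)) (sym (degSum-⊤ G)) (≐-÷ _ (totalDegree G))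

  p≤q : p ℕ.≤ q
  p≤q = subst₂ ℕ._≤_ (ℕ.*-identityʳ p) (ℕ.*-identityˡ q) (≤⇒≐ τ≐ (≐-ℕ 1) τ≤1)

  sparse′ : ∀ σ → 2 ℕ.≤ ∣ σ ∣ → codegree G σ ℕ.* (Z ℕ.* n ℕ.* q ℕ.^ (∣ σ ∣ ℕ.∸ 1)) ℕ.≤ totalDegree G ℕ.* p ℕ.^ (∣ σ ∣ ℕ.∸ 1)
  sparse′ σ σ≥2 = subst₂ ℕ._≤_ (cong (ℕ._* (Z ℕ.* n ℕ.* q ℕ.^ k)) (codeg≡ G σ)) (shuffle (totalDegree G) (p ℕ.^ k))
    (≤⇒≐ {{_}} {{ℕ.m*n≢0 (Z ℕ.* n) _ {{ℕ.m*n≢0 Z n}} {{q^k≢0 k}}}} (≐-ℕ (codeg G σ)) (≐-* (≐-* c≐ avg≐) (≐-^ k τ≐)) (sparse σ σ≥2))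
    where
    k = ∣ σ ∣ ℕ.∸ 1
    shuffle : ∀ D u → 1 ℕ.* D ℕ.* u ℕ.* 1 ≡ D ℕ.* u
    shuffle = solve-∀

  open Containers G cst p q uniform public using (container)
  open Containers G cst p q uniform hiding (container)

  container-prefix : (T : Subset n) (w : ℕ) → container T ∩ prefix n w ≡ container (T ∩ prefix n w) ∩ prefix n w
  container-prefix T w = mem-ext agree
    where
    agree : ∀ t → t ℕ.< n → mem (container T ∩ prefix n w) t ≡ mem (container (T ∩ prefix n w) ∩ prefix n w) t
    agree t t<n = trans (mem-∩ (container T) (prefix n w) t) (trans same (sym (mem-∩ (container (T ∩ prefix n w)) (prefix n w) t)))
      where
      same : mem (container T) t ∧ mem (prefix n w) t ≡ mem (container (T ∩ prefix n w)) t ∧ mem (prefix n w) t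
      same = ∧-congʳ-when (mem (prefix n w) t) λ t∈w → container-online T (T ∩ prefix n w) t t<n λ s s≤t →
        sym (trans (mem-∩ T (prefix n w) s) (trans (cong (mem T s ∧_) (earlier s s≤t t∈w)) (∧-identityʳ _)))
        where
        earlier : ∀ s → s ℕ.≤ t → mem (prefix n w) t ≡ true → mem (prefix n w) s ≡ true
        earlier s s≤t t∈w = trans (mem-prefix w s (ℕ.≤-<-trans s≤t t<n)) (T⇒≡ (ℕ.<⇒<ᵇ (ℕ.≤-<-trans s≤t
          (ℕ.<ᵇ⇒< t w (≡⇒T (trans (sym (mem-prefix w t t<n)) t∈w))))))

  module _ (I : Subset n) where

    open ForSet sparse′ I
    open InducedBound T (λ _ _ → refl)

    T⊆I : T ⊆ I
    T⊆I = mem⇒⊆ (fingerprint⊆ I)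

    -- The two available bounds on `|P r|`: `(a / b)^r n d`, or `(a / b)^ρ d |T| / (2 E)`.
    SmallLeftover : Set
    SmallLeftover = b ℕ.^ suc ρ ℕ.* size (final (suc ρ)) ℕ.≤ a ℕ.^ suc ρ ℕ.* D
      ⊎ 2 ℕ.* E ℕ.* n ℕ.* b ℕ.^ ρ ℕ.* size (final (suc ρ)) ℕ.≤ a ℕ.^ ρ ℕ.* D ℕ.* ∣ T ∣

    few-edges : eInd G I ℕ.* (Z ℕ.* q ℕ.^ suc ρ) ℕ.≤ p ℕ.^ suc ρ ℕ.* size G → SmallLeftover
    few-edges few = inj₁ (begin
      b ℕ.^ suc ρ ℕ.* size (final (suc ρ))
        ≤⟨ ℕ.*-monoʳ-≤ (b ℕ.^ suc ρ) (ℕ.≤-trans induced-bound (ℕ.≤-trans (induced-mono G T⊆I) (ℕ.≤-reflexive (sym (eInd≡ G I))))) ⟩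
      b ℕ.^ suc ρ ℕ.* eInd G I                               ≡⟨ cong (ℕ._* eInd G I) (^-distrib-* (suc ρ) Δ q) ⟩
      Δ ℕ.^ suc ρ ℕ.* q ℕ.^ suc ρ ℕ.* eInd G I
        ≤⟨ ℕ.*-monoˡ-≤ (eInd G I) (ℕ.*-monoˡ-≤ (q ℕ.^ suc ρ) (ℕ.≤-trans (ℕ.m≤n*m _ (2 ℕ.* E) {{ℕ.m*n≢0 2 E {{_}} {{>-nonZero E>0}}}}) (Z-split (suc ρ) ℕ.≤-refl))) ⟩
      Z ℕ.* q ℕ.^ suc ρ ℕ.* eInd G I                         ≡⟨ ℕ.*-comm _ (eInd G I) ⟩
      eInd G I ℕ.* (Z ℕ.* q ℕ.^ suc ρ)                       ≤⟨ few ⟩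
      p ℕ.^ suc ρ ℕ.* size G                                 ≤⟨ ℕ.*-monoʳ-≤ (p ℕ.^ suc ρ) ε≤D ⟩
      a ℕ.^ suc ρ ℕ.* D                                      ∎)
      where open ℕ.≤-Reasoning

    low-degree : ∀ k → k ℕ.* (Z ℕ.* q ℕ.^ ρ ℕ.* n) ℕ.≤ p ℕ.^ ρ ℕ.* D → ∑ G (λ f → [[ sub f T ]]) ℕ.≤ k ℕ.* ∣ T ∣ → SmallLeftover
    low-degree k k≤ few = inj₂ (begin
      2 ℕ.* E ℕ.* n ℕ.* b ℕ.^ ρ ℕ.* size (final (suc ρ))     ≤⟨ ℕ.*-monoʳ-≤ (2 ℕ.* E ℕ.* n ℕ.* b ℕ.^ ρ) (ℕ.≤-trans induced-bound few) ⟩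
      2 ℕ.* E ℕ.* n ℕ.* b ℕ.^ ρ ℕ.* (k ℕ.* ∣ T ∣)            ≡⟨ cong (λ z → 2 ℕ.* E ℕ.* n ℕ.* z ℕ.* (k ℕ.* ∣ T ∣)) (^-distrib-* ρ Δ q) ⟩
      2 ℕ.* E ℕ.* n ℕ.* (Δ ℕ.^ ρ ℕ.* q ℕ.^ ρ) ℕ.* (k ℕ.* ∣ T ∣) ≡⟨ shuffle₁ (2 ℕ.* E) n (Δ ℕ.^ ρ) (q ℕ.^ ρ) k ∣ T ∣ ⟩
      2 ℕ.* E ℕ.* Δ ℕ.^ ρ ℕ.* (q ℕ.^ ρ ℕ.* n ℕ.* k ℕ.* ∣ T ∣) ≤⟨ ℕ.*-monoˡ-≤ (q ℕ.^ ρ ℕ.* n ℕ.* k ℕ.* ∣ T ∣) (Z-split ρ (ℕ.n≤1+n ρ)) ⟩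
      Z ℕ.* (q ℕ.^ ρ ℕ.* n ℕ.* k ℕ.* ∣ T ∣)                  ≡⟨ shuffle₂ Z (q ℕ.^ ρ) n k ∣ T ∣ ⟩
      k ℕ.* (Z ℕ.* q ℕ.^ ρ ℕ.* n) ℕ.* ∣ T ∣                  ≤⟨ ℕ.*-monoˡ-≤ ∣ T ∣ k≤ ⟩
      a ℕ.^ ρ ℕ.* D ℕ.* ∣ T ∣                                ∎)
      where
      open ℕ.≤-Reasoning
      shuffle₁ : ∀ x n d u k t → x ℕ.* n ℕ.* (d ℕ.* u) ℕ.* (k ℕ.* t) ≡ x ℕ.* d ℕ.* (u ℕ.* n ℕ.* k ℕ.* t)
      shuffle₁ = solve-∀
      shuffle₂ : ∀ Z u n k t → Z ℕ.* (u ℕ.* n ℕ.* k ℕ.* t) ≡ k ℕ.* (Z ℕ.* u ℕ.* n) ℕ.* t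
      shuffle₂ = solve-∀

    Hypothesis : Set
    Hypothesis = Independent G I
      ⊎ Degenerate G (floor (c * (τ ^ℚ ρ) * avgDeg G)) I
      ⊎ ℕtoℚ (eInd G I) ≤ c * (τ ^ℚ suc ρ) * ℕtoℚ (e G)

    small-leftover : Hypothesis → SmallLeftover
    -- An independent set is treated as a set with few, namely no, induced edges.
    small-leftover (inj₁ independent) = few-edges (subst (λ z → z ℕ.* (Z ℕ.* q ℕ.^ suc ρ) ℕ.≤ p ℕ.^ suc ρ ℕ.* size G)
      (sym (independent⇒induced≡0 G uniform independent)) z≤n)
    small-leftover (inj₂ (inj₁ degenerate)) with ⌊⌋-truncated (c * (τ ^ℚ ρ) * avgDeg G)
    -- Vertices are deleted from `T`, not from `I`: a bound in terms of `|T|` can be absorbed, while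
    -- `|I|` is not controlled.
    ... | k , z≤k , bound = low-degree k (k≤ bound) (induced-degenerate G uniform degenerate z≤k ∣ T ∣ T ℕ.≤-refl T⊆I)
      where
      k≤ : k ≡ 0 ⊎ ℕtoℚ k ≤ c * (τ ^ℚ ρ) * avgDeg G → k ℕ.* (Z ℕ.* q ℕ.^ ρ ℕ.* n) ℕ.≤ p ℕ.^ ρ ℕ.* D
      k≤ (inj₁ refl) = z≤n
      k≤ (inj₂ k≤x)  = subst (k ℕ.* (Z ℕ.* q ℕ.^ ρ ℕ.* n) ℕ.≤_) (shuffle (p ℕ.^ ρ) D)
        (≤⇒≐ {{_}} {{ℕ.m*n≢0 (Z ℕ.* q ℕ.^ ρ) n {{ℕ.m*n≢0 Z (q ℕ.^ ρ) {{Z≢0}} {{q^k≢0 ρ}}}}}} (≐-ℕ k) (≐-* (≐-* c≐ (≐-^ ρ τ≐)) avg≐) k≤x)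
        where
        shuffle : ∀ u D → 1 ℕ.* u ℕ.* D ℕ.* 1 ≡ u ℕ.* D
        shuffle = solve-∀
    small-leftover (inj₂ (inj₂ few)) = few-edges (subst₂ ℕ._≤_ (shuffle₁ (eInd G I) Z (q ℕ.^ suc ρ))
        (trans (shuffle₂ (p ℕ.^ suc ρ) (e G)) (cong (p ℕ.^ suc ρ ℕ.*_) (length≡∑ G)))
      (≤⇒≐ {{_}} {{ℕ.m*n≢0 (Z ℕ.* q ℕ.^ suc ρ) 1 {{ℕ.m*n≢0 Z (q ℕ.^ suc ρ) {{Z≢0}} {{q^k≢0 (suc ρ)}}}}}} (≐-ℕ (eInd G I)) (≐-* (≐-* c≐ (≐-^ (suc ρ) τ≐)) (≐-ℕ (e G))) few))
      where
      shuffle₁ : ∀ x Z u → x ℕ.* (Z ℕ.* u ℕ.* 1) ≡ x ℕ.* (Z ℕ.* u)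
      shuffle₁ = solve-∀
      shuffle₂ : ∀ u e → 1 ℕ.* u ℕ.* e ℕ.* 1 ≡ u ℕ.* e
      shuffle₂ = solve-∀

    contained : Hypothesis → ∃ λ T → T ⊆ I × I ⊆ container T × μ G T ≤ τ × ℕtoℚ ∣ T ∣ ≤ τ * ℕtoℚ n × μ G (container T) ≤ 1ℚ - c
    contained hyp = T , T⊆I , mem⇒⊆ (⊆container I)
      , ≐⇒≤ (μ≐ T) τ≐ (ℕ.≤-trans (ℕ.≤-reflexive (ℕ.*-comm (weight d T) q)) (weight-bound h))
      , ≐⇒≤ {{_}} {{ℕ.m*n≢0 q 1}} (≐-ℕ ∣ T ∣) (≐-* τ≐ (≐-ℕ n)) (subst₂ ℕ._≤_ (shuffle₁ q ∣ T ∣) (sym (ℕ.*-identityʳ (p ℕ.* n))) (card-bound h))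
      , ≐⇒≤ (μ≐ (container T)) (≐-1- c≐) (begin
          dC ℕ.* Z              ≡⟨ ℕ.*-comm dC Z ⟩
          Z ℕ.* dC              ≤⟨ ℕ.m+n≤o⇒m≤o∸n (Z ℕ.* dC) (container-weight h p≤q) ⟩
          Z ℕ.* D ℕ.∸ D         ≡⟨ cong (Z ℕ.* D ℕ.∸_) (ℕ.*-identityˡ D) ⟨
          Z ℕ.* D ℕ.∸ 1 ℕ.* D   ≡⟨ ℕ.*-distribʳ-∸ D Z 1 ⟨
          (Z ℕ.∸ 1) ℕ.* D       ∎)
      where
      open ℕ.≤-Reasoning
      h : SmallLeftover
      h = small-leftover hyp
      shuffle₁ : ∀ q t → q ℕ.* t ≡ t ℕ.* (q ℕ.* 1)
      shuffle₁ = solve-∀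

theorem1p2 : (r : ℕ) →
    Σ ℚ λ c → 0ℚ < c ×
    ((n : ℕ) (G : Hypergraph n) → Unique G → All (λ f → ∣ f ∣ ≡ r) G →
    0ℚ < avgDeg G →
    (τ : ℚ) → 0ℚ < τ → τ ≤ 1ℚ →
    ((σ : Subset n) → 2 ℕ.≤ ∣ σ ∣ →
    ℕtoℚ (codeg G σ) ≤ c * avgDeg G * (τ ^ℚ (∣ σ ∣ ℕ.∸ 1))) →
    Σ (Subset n → Subset n) λ C →
    ((I : Subset n) →
    (Independent G I
    ⊎ Degenerate G (floor (c * (τ ^ℚ (r ℕ.∸ 1)) * avgDeg G)) I
    ⊎ ℕtoℚ (eInd G I) ≤ c * (τ ^ℚ r) * ℕtoℚ (e G)) →
    ∃ λ T → T ⊆ I ×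
    I ⊆ C T ×
    μ G T ≤ τ ×
    ℕtoℚ ∣ T ∣ ≤ τ * ℕtoℚ n ×
    μ G (C T) ≤ 1ℚ - c)
    ×
    ((T : Subset n) (w : ℕ) → 1 ℕ.≤ w → w ℕ.≤ n →
    C T ∩ prefix n w ≡ C (T ∩ prefix n w) ∩ prefix n w))
-- All edges are empty, so the degree sum is 0, contrary to positive average degree.
theorem1p2 zero    = 1ℚ , ℚ.positive⁻¹ 1ℚ , λ n G _ uniform 0<avg →
  contradiction (trans (degSum-⊤ G) (totalDegree-uniform G uniform)) (ℕ.≢-nonZero⁻¹ _ {{proj₁ (÷-positive _ n 0<avg)}})
theorem1p2 (suc ρ) = 1 ÷ℕ Z , 0<1÷ Z {{>-nonZero Z>0}} , λ n G _ uniform 0<avg τ 0<τ τ≤1 sparse →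
  let p , q , p≢0 , q≢0 , τ≐ = positive-fraction τ 0<τ
      degSum≢0 , n≢0         = ÷-positive (degSum G ⊤) n 0<avg
      D≢0                    = subst NonZero (degSum-⊤ G) degSum≢0
      e≢0                    = ℕ.m*n≢0⇒n≢0 (suc ρ) {{subst NonZero (totalDegree-uniform G uniform) D≢0}}
      open Graph (constants ρ) G uniform τ≐ τ≤1 {{p≢0}} {{q≢0}} {{n≢0}} {{D≢0}} {{e≢0}} sparse
  in  container , contained , λ T w _ _ → container-prefix T w
  where
  open Constants (constants ρ)
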